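{- Let $G$ be a finite $3$-regular graph with (vertex) connectivity $3$, and let $L$ be a $3$-assignment for $G$. Then $G$ is $L$-swappable unless either (a) $G=K_4$, or (b) $G=K_2\,\square\,K_3$ and $L(v)=L(w)$ for all $v,w\in V(G)$.
   Context: A list-assignment $L$ assigns to each vertex $v$ a set $L(v)$ of colors; a $3$-assignment has $|L(v)|=3$ for all $v$. An $L$-coloring is a proper coloring $\varphi$ with $\varphi(v)\in L(v)$. An $\alpha,\beta$-Kempe swap at a vertex $u$ with $\varphi(u)\in\{\alpha,\beta\}$ interchanges $\alpha$ and $\beta$ on the component containing $u$ of the subgraph induced by vertices colored $\alpha$ or $\beta$; it is $L$-valid if the result is again an $L$-coloring. Two $L$-colorings are $L$-equivalent if one is obtained from the other by a sequence of $L$-valid Kempe swaps. $G$ is $L$-swappable if it has an $L$-coloring and all its $L$-colorings are pairwise $L$-equivalent. $K_2\,\square\,K_3$ denotes the Cartesian product of $K_2$ and $K_3$ (the triangular prism). -}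

module Defs where

open import Data.Nat using (ℕ; zero; suc; _<_)
open import Data.Fin using (Fin)
open import Data.Fin.Subset using (Subset; ∣_∣; _∉_)
open import Data.Bool using (Bool; true; false; if_then_else_)
open import Data.Vec using (tabulate)
open import Data.Product using (Σ; ∃; _×_; _,_)
open import Data.Sum using (_⊎_)
open import Data.List using (List; length)
open import Data.List.Membership.Propositional using (_∈_)
open import Data.List.Relation.Unary.Unique.Propositional using (Unique)
open import Data.Nat using (_≟_)
open import Relation.Nullary using (¬_; does)
open import Relation.Binary.PropositionalEquality using (_≡_; _≢_)
open import Relation.Binary.Construct.Closure.ReflexiveTransitive using (Star)
open import Function.Bundles using (_⤖_; _⇔_; Bijection)

record Graph (n : ℕ) : Set where
  field
    adj    : Fin n → Fin n → Bool
    sym    : ∀ u v → adj u v ≡ adj v u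
    irrefl : ∀ v → adj v v ≡ false
open Graph public

module _ {n : ℕ} (G : Graph n) where

  Adj : Fin n → Fin n → Set
  Adj u v = adj G u v ≡ true

  degree : Fin n → ℕ
  degree v = ∣ tabulate (adj G v) ∣

  Regular : ℕ → Set
  Regular d = ∀ v → degree v ≡ d

  data Reach (P : Fin n → Set) : Fin n → Fin n → Set where
    here : ∀ {u} → P u → Reach P u u
    step : ∀ {u w v} → P u → Adj u w → Reach P w v → Reach P u v

  NontrivConnectedMinus : Subset n → Set
  NontrivConnectedMinus S =
    (Σ (Fin n) λ u → Σ (Fin n) λ v → u ≢ v × u ∉ S × v ∉ S)
    × (∀ u v → u ∉ S → v ∉ S → Reach (λ w → w ∉ S) u v)

  -- k-connected (Diestel): |G| > k and G − X connected for all |X| < k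
  KConnected : ℕ → Set
  KConnected k = ∀ (S : Subset n) → ∣ S ∣ < k → NontrivConnectedMinus S

  Connectivity≡ : ℕ → Set
  Connectivity≡ k = KConnected k × ¬ KConnected (suc k)

  IsoTo : (V : Set) → (V → V → Set) → Set
  IsoTo V R = Σ (Fin n ⤖ V) λ f →
    ∀ u v → Adj u v ⇔ R (Bijection.to f u) (Bijection.to f v)

Colour : Set
Colour = ℕ

ListAssignment : ℕ → Set
ListAssignment n = Fin n → List Colour

IsKAssignment : ∀ {n} → ℕ → ListAssignment n → Set
IsKAssignment k L = ∀ v → Unique (L v) × length (L v) ≡ k

module _ {n : ℕ} (G : Graph n) (L : ListAssignment n) where

  IsLColouring : (Fin n → Colour) → Set
  IsLColouring φ = (∀ u v → Adj G u v → φ u ≢ φ v) × (∀ v → φ v ∈ L v)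

  swapCol : Colour → Colour → Colour → Colour
  swapCol α β c = if does (c ≟ α) then β else (if does (c ≟ β) then α else c)

  KempeSwap : (Fin n → Colour) → (Fin n → Colour) → Set
  KempeSwap φ ψ = Σ Colour λ α → Σ Colour λ β → Σ (Fin n) λ u →
    (φ u ≡ α ⊎ φ u ≡ β) ×
    (∀ v → (Reach G (λ w → φ w ≡ α ⊎ φ w ≡ β) u v → ψ v ≡ swapCol α β (φ v))
         × (¬ Reach G (λ w → φ w ≡ α ⊎ φ w ≡ β) u v → ψ v ≡ φ v))

  LValidSwap : (Fin n → Colour) → (Fin n → Colour) → Set
  LValidSwap φ ψ = IsLColouring φ × IsLColouring ψ × KempeSwap φ ψ

  LEquivalent : (Fin n → Colour) → (Fin n → Colour) → Set
  LEquivalent = Star LValidSwap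

  LSwappable : Set
  LSwappable = (∃ λ φ → IsLColouring φ)
    × (∀ φ ψ → IsLColouring φ → IsLColouring ψ → LEquivalent φ ψ)

K4Adj : Fin 4 → Fin 4 → Set
K4Adj u v = u ≢ v

PrismAdj : Fin 2 × Fin 3 → Fin 2 × Fin 3 → Set
PrismAdj (i , j) (i' , j') = (i ≡ i' × j ≢ j') ⊎ (i ≢ i' × j ≡ j')

AllListsEqual : ∀ {n} → ListAssignment n → Set
AllListsEqual {n} L = ∀ (v w : Fin n) (c : Colour) → (c ∈ L v) ⇔ (c ∈ L w)

{-# OPTIONS --safe #-}
module Submission where

-- Fix the colours of a few vertices. If every other vertex is joined, off the fixed ones, to a
-- vertex seeing a redundant fixed colour, then the colouring extends, and all extensions are
-- equivalent (Las Vergnas and Meyniel's degeneracy argument, for lists).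
--
-- If α ∈ L u and α ∉ L v for an edge u v, the colourings with u coloured α thus form one class.
-- Two such classes nearly always share a colouring. An arbitrary φ reaches the class by a swap at
-- u, unless that swap is invalid, and then φ lies in another class of this kind.
--
-- If all lists agree, the colourings giving the same colour to two nonadjacent neighbours x, y of a
-- vertex form one class C(x, y), and these classes cover everything. Classes C(u, a) and C(u, b)
-- meet as soon as u, a, b can receive one colour, which is a connectivity question off u, a, b.
-- Triangles and four-cycles give such triples directly; in girth at least five the only
-- obstructions to joining the classes C(u, a) with a at distance two from u are five-cycles and
-- 3-vertex cuts.

open import Defs
open import Data.Nat using (ℕ; zero; suc; _≤_; _<_; z≤n; s≤s) renaming (_≟_ to _≟ᶜ_)
open import Data.Nat.Properties using (≤-refl; ≤-trans; ≤-reflexive; +-cancelʳ-≤; +-suc; ≤-pred; 1+n≰n; n≤1+n)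
import Data.Nat as ℕ
open import Data.Fin using (Fin; zero; suc; _≟_)
open import Data.Fin.Patterns using (0F; 1F; 2F; 3F)
open import Data.Fin.Properties using (any?)
open import Data.Fin.Subset using (Subset; ⁅_⁆; _∪_; ∣_∣)
open import Data.Fin.Subset.Properties using (x∈⁅y⁆⇒x≡y; x∈⁅x⁆; x∈p∪q⁻; x∈p∪q⁺; ∣⁅x⁆∣≡1; ∪-identityˡ; ∣⊥∣≡0)
import Data.Fin.Subset as Sub
open import Data.Bool using (Bool; true; false; if_then_else_; _∧_; not)
import Data.Bool.Properties as 𝔹
open import Data.Product using (∃; _×_; _,_; _,′_; proj₁; proj₂)
open import Data.Sum using (_⊎_; inj₁; inj₂; [_,_]′; swap)
open import Data.Empty using (⊥; ⊥-elim)
open import Data.Unit using (⊤; tt)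
open import Data.List using (List; []; _∷_; length; map; filter; allFin; _++_)
import Data.List as List
import Data.Vec as Vec
open import Data.List.Properties using (filter-notAll; length-map; length-++)
open import Data.List.Membership.Propositional using (_∈_; _∉_; find; lose)
open import Data.List.Membership.Propositional.Properties using (∈-filter⁺; ∈-filter⁻; ∈-allFin; ∈-map⁺; ∈-++⁺ˡ; ∈-++⁺ʳ; ∈-++⁻)
import Data.List.Membership.DecPropositional as DecMembership
open import Data.List.Relation.Unary.Any using (here; there)
import Data.List.Relation.Unary.Any as Any
open import Data.List.Relation.Unary.All using ([]; _∷_)
import Data.List.Relation.Unary.All as All
open import Data.List.Relation.Unary.AllPairs using ([]; _∷_)
open import Data.List.Relation.Unary.Unique.Propositional using (Unique)
import Data.List.Relation.Unary.Unique.Propositional.Properties as Unique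
open import Relation.Nullary using (¬_; Dec; yes; no; does; contradiction)
open import Relation.Nullary.Decidable using (¬?; _×-dec_; _⊎-dec_; map′; dec-true; dec-false)
open import Relation.Unary using (Decidable)
open import Relation.Binary.PropositionalEquality using (_≡_; _≢_; refl; trans; cong; cong₂; subst; subst₂; ≢-sym) renaming (sym to ≡-sym)
open import Relation.Binary.Construct.Closure.ReflexiveTransitive using (ε; _◅_; _◅◅_)
open import Function using (_∘_; id; case_of_)
open import Function.Bundles using (mk⇔; mk⤖)

-- Connectivity 3 is the resource that shapes the argument. Deleting one or two vertices leaves the
-- graph connected, so when one vertex or a pair is fixed, a single vertex with a redundant colour
-- serves the whole remainder. Three fixed vertices may separate the graph, and most case
-- distinctions for equal lists exist to show that each component left by a triple contains a vertex
-- adjacent to two of its members. Where that fails for one triple, the classes are joined along a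
-- detour through other triples. In the Petersen graph the neighbourhood of a vertex fails the test,
-- and there a second colour class is fixed as well. A fixed colour is redundant for a vertex if it
-- is absent from the list or occurs on two neighbours: the vertex then loses more neighbours than
-- colours. The obstacle in the degeneracy argument is a Kempe chain that passes through the deleted
-- vertex `s`. Having more colours than neighbours, `s` either can leave the two colours of the swap
-- or has at most one neighbour in them.

remove : ∀ {A : Set} {x : A} {xs} → x ∈ xs →
  ∃ λ ys → length xs ≡ suc (length ys) × (∀ {y} → y ∈ xs → y ≢ x → y ∈ ys)
remove {xs = x ∷ xs} (here refl) = xs , refl , λ where
  (here y≡x) y≢x → contradiction y≡x y≢x
  (there y∈) _ → y∈
remove {xs = z ∷ xs} (there x∈xs) with remove x∈xs
... | ys , len , keep = z ∷ ys , cong suc len , λ where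
  (here y≡z) _ → here y≡z
  (there y∈) y≢x → there (keep y∈ y≢x)

-- The pigeonhole principle by which colours are counted against neighbours: each element of `xs`
-- uses up one occurrence in `ys`.
⊆⇒length≤ : ∀ {A : Set} {xs ys : List A} → Unique xs → (∀ {x} → x ∈ xs → x ∈ ys) →
  length xs ≤ length ys
⊆⇒length≤ {xs = []} _ _ = z≤n
⊆⇒length≤ {xs = x ∷ xs} (x∉ ∷ u) sub with remove (sub (here refl))
... | zs , len , keep rewrite len =
  s≤s (⊆⇒length≤ u λ y∈ → keep (sub (there y∈)) λ y≡x → All.lookup x∉ y∈ (≡-sym y≡x))

filter-length-split : ∀ {A : Set} {P : A → Set} (P? : Decidable P) (xs : List A) →
  length (filter (¬? ∘ P?) xs) ℕ.+ length (filter P? xs) ≡ length xs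
filter-length-split P? [] = refl
filter-length-split P? (x ∷ xs) with P? x
... | yes _ = trans (+-suc _ _) (cong suc (filter-length-split P? xs))
... | no _ = cong suc (filter-length-split P? xs)

module _ {n : ℕ} where
  open DecMembership (_≟_ {n}) public using () renaming (_∈?_ to _∈?ᵛ_)
open DecMembership _≟ᶜ_ public using () renaming (_∈?_ to _∈?ᶜ_)

_[_↦_] : ∀ {n} → (Fin n → Colour) → Fin n → Colour → Fin n → Colour
(φ [ s ↦ c ]) w = if does (w ≟ s) then c else φ w

↦-same : ∀ {n} (φ : Fin n → Colour) s c → (φ [ s ↦ c ]) s ≡ c
↦-same φ s c with s ≟ s
... | yes _ = refl
... | no s≢s = contradiction refl s≢s

↦-other : ∀ {n} (φ : Fin n → Colour) s c {w} → w ≢ s → (φ [ s ↦ c ]) w ≡ φ w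
↦-other φ s c {w} w≢s with w ≟ s
... | yes w≡s = contradiction w≡s w≢s
... | no _ = refl

-- Reachability

module _ {n : ℕ} (G : Graph n) where

  adj-sym : ∀ {u v} → Adj G u v → Adj G v u
  adj-sym {u} {v} a = trans (Graph.sym G v u) a

  adj⇒≢ : ∀ {u v} → Adj G u v → u ≢ v
  adj⇒≢ {u} a refl with () ← trans (≡-sym a) (irrefl G u)

  adj? : ∀ u v → Dec (Adj G u v)
  adj? u v = adj G u v 𝔹.≟ true

module _ {n : ℕ} {G : Graph n} where

  reach-source : ∀ {P u v} → Reach G P u v → P u
  reach-source (here p) = p
  reach-source (step p _ _) = p

  reach-target : ∀ {P u v} → Reach G P u v → P v
  reach-target (here p) = p
  reach-target (step _ _ r) = reach-target r

  reach-map : ∀ {P Q u v} → (∀ {w} → P w → Q w) → Reach G P u v → Reach G Q u v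
  reach-map f (here p) = here (f p)
  reach-map f (step p a r) = step (f p) a (reach-map f r)

  reach-trans : ∀ {P u v w} → Reach G P u v → Reach G P v w → Reach G P u w
  reach-trans (here _) s = s
  reach-trans (step p a r) s = step p a (reach-trans r s)

  reach-snoc : ∀ {P u v w} → Reach G P u v → Adj G v w → P w → Reach G P u w
  reach-snoc r a p = reach-trans r (step (reach-target r) a (here p))

  reach-sym : ∀ {P u v} → Reach G P u v → Reach G P v u
  reach-sym (here p) = here p
  reach-sym (step p a r) = reach-snoc (reach-sym r) (adj-sym G a) p

  -- The main tool for walks. Connectivity supplies walks off two vertices; cutting at the first
  -- vertex of `Q` yields a walk off further vertices, together with the edge by which they would be
  -- entered.
  first-hit : ∀ {P Q : Fin n → Set} → Decidable Q → ∀ {u v} → Reach G P u v → ¬ Q u →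
    Reach G (λ w → P w × ¬ Q w) u v ⊎
    (∃ λ m → ∃ λ q → Reach G (λ w → P w × ¬ Q w) u m × Adj G m q × P q × Q q)
  first-hit Q? (here p) ¬q = inj₁ (here (p , ¬q))
  first-hit Q? (step {w = w} p a r) ¬q with Q? w
  ... | yes q = inj₂ (_ , w , here (p , ¬q) , a , reach-source r , q)
  ... | no ¬q′ with first-hit Q? r ¬q′
  ...   | inj₁ r′ = inj₁ (step (p , ¬q) a r′)
  ...   | inj₂ (m , q , r′ , rest) = inj₂ (m , q , step (p , ¬q) a r′ , rest)

  crossing : ∀ {P Q : Fin n → Set} → Decidable Q → ∀ {u v} → Reach G P u v → ¬ Q u → Q v →
    ∃ λ m → ∃ λ q → P m × P q × Adj G m q × ¬ Q m × Q q
  crossing Q? r ¬q q with first-hit Q? r ¬q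
  ... | inj₁ r′ = contradiction q (proj₂ (reach-target r′))
  ... | inj₂ (m , x , r′ , a , px , qx) =
    m , x , proj₁ (reach-target r′) , px , a , proj₂ (reach-target r′) , qx

  reach-closed : ∀ {P Q : Fin n → Set} → (∀ {x y} → Q x → Adj G x y → P y → Q y) →
    ∀ {u v} → Q u → Reach G P u v → Q v
  reach-closed cl q (here _) = q
  reach-closed cl q (step _ a r) = reach-closed cl (cl q a (reach-source r)) r

module _ {n : ℕ} (G : Graph n) {P : Fin n → Set} (P? : Decidable P) where

  private
    In : List (Fin n) → Fin n → Set
    In W w = P w × w ∈ W

    _∖_ : List (Fin n) → Fin n → List (Fin n)
    W ∖ u = filter (λ w → ¬? (w ≟ u)) W

    -- Completeness of the search below: a walk through `u` may be replaced by its part after the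
    -- last visit to `u`, so it suffices to search from the neighbours of `u` with `u` struck off.
    erase : ∀ W u {x v} → Reach G (In W) x v →
      Reach G (In (W ∖ u)) x v ⊎ u ≡ v ⊎ (∃ λ w → Adj G u w × Reach G (In (W ∖ u)) w v)
    erase W u {x} (here (p , x∈)) with x ≟ u
    ... | yes x≡u = inj₂ (inj₁ (≡-sym x≡u))
    ... | no x≢u = inj₁ (here (p , ∈-filter⁺ (λ w → ¬? (w ≟ u)) x∈ x≢u))
    erase W u {x} (step (p , x∈) a r) with erase W u r
    ... | inj₂ e = inj₂ e
    ... | inj₁ r′ with x ≟ u
    ...   | yes refl = inj₂ (inj₂ (_ , a , r′))
    ...   | no x≢u = inj₁ (step (p , ∈-filter⁺ (λ w → ¬? (w ≟ u)) x∈ x≢u) a r′)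

    reachIn? : ∀ k W → length W ≤ k → ∀ u v → Dec (Reach G (In W) u v)
    reachIn? k W len u v with P? u | u ∈?ᵛ W
    ... | no ¬p | _ = no (¬p ∘ proj₁ ∘ reach-source)
    ... | yes _ | no u∉ = no (u∉ ∘ proj₂ ∘ reach-source)
    reachIn? zero [] z≤n u v | yes _ | yes ()
    reachIn? (suc k) W len u v | yes p | yes u∈ with u ≟ v
    ... | yes refl = yes (here (p , u∈))
    ... | no u≢v with any? (λ w → adj? G u w ×-dec reachIn? k (W ∖ u) shorter w v)
      where
      shorter : length (W ∖ u) ≤ k
      shorter = ≤-pred (≤-trans
        (filter-notAll (λ w → ¬? (w ≟ u)) W (Any.map (λ u≡w w≢u → w≢u (≡-sym u≡w)) u∈)) len)
    ...   | yes (w , a , r) = yes (step (p , u∈) a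
              (reach-map (λ (q , w∈) → q , proj₁ (∈-filter⁻ (λ w → ¬? (w ≟ u)) {xs = W} w∈)) r))
    ...   | no ¬r = no λ r → case erase W u r of λ where
              (inj₁ r′) → proj₂ (∈-filter⁻ (λ w → ¬? (w ≟ u)) {xs = W} (proj₂ (reach-source r′))) refl
              (inj₂ (inj₁ u≡v)) → u≢v u≡v
              (inj₂ (inj₂ (w , a , r′))) → ¬r (w , a , r′)

  abstract
    reach? : ∀ u v → Dec (Reach G P u v)
    reach? u v = map′ (reach-map proj₁) (reach-map λ p → p , ∈-allFin _)
      (reachIn? (length (allFin n)) (allFin n) ≤-refl u v)

-- Kempe swaps

-- This is `swapCol` freed from its graph and list parameters. Both unfold to the same term, so an
-- `IsSwap` serves directly as the last component of a `KempeSwap`.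
sw : Colour → Colour → Colour → Colour
sw α β c = if does (c ≟ᶜ α) then β else (if does (c ≟ᶜ β) then α else c)

sw-α : ∀ α β → sw α β α ≡ β
sw-α α β rewrite dec-true (α ≟ᶜ α) refl = refl

sw-β : ∀ α β → sw α β β ≡ α
sw-β α β with β ≟ᶜ α
... | yes refl rewrite dec-true (β ≟ᶜ β) refl = refl
... | no β≢α rewrite dec-false (β ≟ᶜ α) β≢α | dec-true (β ≟ᶜ β) refl = refl

sw-mem : ∀ {α β c} → c ≡ α ⊎ c ≡ β → sw α β c ≡ α ⊎ sw α β c ≡ β
sw-mem {α} {β} (inj₁ refl) = inj₂ (sw-α α β)
sw-mem {α} {β} (inj₂ refl) = inj₁ (sw-β α β)

sw-invol : ∀ {α β c} → c ≡ α ⊎ c ≡ β → sw α β (sw α β c) ≡ c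
sw-invol {α} {β} (inj₁ refl) rewrite sw-α α β = sw-β α β
sw-invol {α} {β} (inj₂ refl) rewrite sw-β α β = sw-α α β

sw-other : ∀ {α β c d} → c ≡ α ⊎ c ≡ β → d ≡ α ⊎ d ≡ β → c ≢ d → sw α β c ≡ d
sw-other (inj₁ refl) (inj₁ refl) c≢d = contradiction refl c≢d
sw-other {α} {β} (inj₁ refl) (inj₂ refl) _ = sw-α α β
sw-other {α} {β} (inj₂ refl) (inj₁ refl) _ = sw-β α β
sw-other (inj₂ refl) (inj₂ refl) c≢d = contradiction refl c≢d

sw-diag : ∀ α c → sw α α c ≡ c
sw-diag α c with c ≟ᶜ α
... | yes refl rewrite dec-true (c ≟ᶜ c) refl = refl
... | no c≢α rewrite dec-false (c ≟ᶜ α) c≢α = refl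

Bi : ∀ {n} → (Fin n → Colour) → Colour → Colour → Fin n → Set
Bi φ α β w = φ w ≡ α ⊎ φ w ≡ β

bi? : ∀ {n} (φ : Fin n → Colour) α β → Decidable (Bi φ α β)
bi? φ α β w = (φ w ≟ᶜ α) ⊎-dec (φ w ≟ᶜ β)

Chain : ∀ {n} → Graph n → (Fin n → Colour) → Colour → Colour → Fin n → Fin n → Set
Chain G φ α β u = Reach G (Bi φ α β) u

chain? : ∀ {n} (G : Graph n) φ α β u → Decidable (Chain G φ α β u)
chain? G φ α β = reach? G (bi? φ α β)

IsSwap : ∀ {n} → Graph n → (φ ψ : Fin n → Colour) → Colour → Colour → Fin n → Set
IsSwap G φ ψ α β u = ∀ v → (Chain G φ α β u v → ψ v ≡ sw α β (φ v)) × (¬ Chain G φ α β u v → ψ v ≡ φ v)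

if-dec : ∀ {P A : Set} (P? : Dec P) {x y : A} →
  (P → (if does P? then x else y) ≡ x) × (¬ P → (if does P? then x else y) ≡ y)
if-dec (yes p) = (λ _ → refl) , contradiction p
if-dec (no ¬p) = (λ p → contradiction p ¬p) , λ _ → refl

abstract
  swapAt : ∀ {n} → Graph n → (Fin n → Colour) → Colour → Colour → Fin n → Fin n → Colour
  swapAt G φ α β u v = if does (chain? G φ α β u v) then sw α β (φ v) else φ v

  swapAt-isSwap : ∀ {n} (G : Graph n) φ α β u → IsSwap G φ (swapAt G φ α β u) α β u
  swapAt-isSwap G φ α β u v = if-dec (chain? G φ α β u v)

Proper : ∀ {n} → Graph n → (Fin n → Colour) → Set
Proper G φ = ∀ u v → Adj G u v → φ u ≢ φ v

-- Inside the chain the exchange is injective. On an edge leaving the chain, equal new colours would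
-- put the outer end among the vertices coloured `α` or `β`, hence into the chain.
swap-proper : ∀ {n} {G : Graph n} {φ ψ α β u} → Proper G φ → IsSwap G φ ψ α β u → Proper G ψ
swap-proper {G = G} {φ} {ψ} {α} {β} {u} pr s x y a ψx≡ψy
  with chain? G φ α β u x | chain? G φ α β u y
... | yes cx | yes cy = pr x y a (trans (≡-sym (sw-invol (reach-target cx)))
        (trans (cong (sw α β) (trans (≡-sym (proj₁ (s x) cx)) (trans ψx≡ψy (proj₁ (s y) cy))))
          (sw-invol (reach-target cy))))
... | yes cx | no ¬cy = ¬cy (reach-snoc cx a (subst (λ c → c ≡ α ⊎ c ≡ β)
        (trans (≡-sym (proj₁ (s x) cx)) (trans ψx≡ψy (proj₂ (s y) ¬cy))) (sw-mem (reach-target cx))))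
... | no ¬cx | yes cy = ¬cx (reach-snoc cy (adj-sym G a) (subst (λ c → c ≡ α ⊎ c ≡ β)
        (trans (≡-sym (proj₁ (s y) cy)) (trans (≡-sym ψx≡ψy) (proj₂ (s x) ¬cx))) (sw-mem (reach-target cy))))
... | no ¬cx | no ¬cy = pr x y a (trans (≡-sym (proj₂ (s x) ¬cx)) (trans ψx≡ψy (proj₂ (s y) ¬cy)))

module _ {n : ℕ} {G : Graph n} {φ ψ : Fin n → Colour} {α β : Colour} {u : Fin n}
         (s : IsSwap G φ ψ α β u) where

  swap-bi : ∀ {w} → Bi φ α β w → Bi ψ α β w
  swap-bi {w} b with chain? G φ α β u w
  ... | yes c = subst (λ d → d ≡ α ⊎ d ≡ β) (≡-sym (proj₁ (s w) c)) (sw-mem b)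
  ... | no ¬c = subst (λ d → d ≡ α ⊎ d ≡ β) (≡-sym (proj₂ (s w) ¬c)) b

  swap-bi⁻ : ∀ {w} → Bi ψ α β w → Bi φ α β w
  swap-bi⁻ {w} b with chain? G φ α β u w
  ... | yes c = reach-target c
  ... | no ¬c = subst (λ d → d ≡ α ⊎ d ≡ β) (proj₂ (s w) ¬c) b

  -- The set of vertices coloured `α` or `β` does not change, so the chain does not either, and the
  -- same swap undoes itself.
  isSwap-sym : IsSwap G ψ φ α β u
  isSwap-sym v = (λ c → let c′ = reach-map swap-bi⁻ c in
        trans (≡-sym (sw-invol (reach-target c′))) (cong (sw α β) (≡-sym (proj₁ (s v) c′))))
    , λ ¬c → ≡-sym (proj₂ (s v) (¬c ∘ reach-map swap-bi))

module _ {n : ℕ} {G : Graph n} {L : ListAssignment n} where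

  ≋-sym : ∀ {φ ψ} → LEquivalent G L φ ψ → LEquivalent G L ψ φ
  ≋-sym ε = ε
  ≋-sym ((cφ , cψ , α , β , u , b , s) ◅ rest) =
    ≋-sym rest ◅◅ ((cψ , cφ , α , β , u , swap-bi s b , isSwap-sym s) ◅ ε)

  ≋-col : ∀ {φ ψ} → IsLColouring G L φ → LEquivalent G L φ ψ → IsLColouring G L ψ
  ≋-col c ε = c
  ≋-col _ ((_ , c , _) ◅ r) = ≋-col c r

  swap-≋ : ∀ {φ ψ α β u} → IsLColouring G L φ → (∀ v → ψ v ∈ L v) → Bi φ α β u → IsSwap G φ ψ α β u → LEquivalent G L φ ψ
  swap-≋ c ψ∈ b s = (c , (swap-proper (proj₁ c) s , ψ∈) , _ , _ , _ , b , s) ◅ ε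

  -- Colourings with equal values need not be identical as functions. The swap with `α` equal to `β`
  -- moves nothing and connects them; it needs some vertex to act on.
  pointwise-≋ : ∀ {φ ψ} → Fin n → IsLColouring G L φ → (∀ w → φ w ≡ ψ w) → LEquivalent G L φ ψ
  pointwise-≋ {φ} {ψ} u c e = swap-≋ c (λ v → subst (_∈ L v) (e v) (proj₂ c v)) (inj₁ refl)
    (λ v → (λ _ → trans (≡-sym (e v)) (≡-sym (sw-diag (φ u) (φ v)))) , λ _ → ≡-sym (e v))

  -- No neighbour of `s` has colour `φ s` or `c`, so the chain of `s` in these colours is `s` alone.
  recolour : ∀ {φ s c} → IsLColouring G L φ → c ∈ L s → (∀ {x} → Adj G s x → φ x ≢ c) →
    IsLColouring G L (φ [ s ↦ c ]) × LEquivalent G L φ (φ [ s ↦ c ])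
  recolour {φ} {s} {c} (pr , ∈L) c∈ free = ≋-col (pr , ∈L) eq , eq
    where
    alone : ∀ {w} → Chain G φ (φ s) c s w → w ≡ s
    alone = reach-closed {Q = _≡ s} (λ where
      refl a (inj₁ e) → contradiction (≡-sym e) (pr _ _ a)
      refl a (inj₂ e) → contradiction e (free a)) refl
    ψ∈ : ∀ v → (φ [ s ↦ c ]) v ∈ L v
    ψ∈ v with v ≟ s
    ... | yes refl = c∈
    ... | no _ = ∈L v
    eq : LEquivalent G L φ (φ [ s ↦ c ])
    eq = swap-≋ (pr , ∈L) ψ∈ (inj₁ refl) λ v →
      (λ ch → subst (λ w → (φ [ s ↦ c ]) w ≡ sw (φ s) c (φ w)) (≡-sym (alone ch))
        (trans (↦-same φ s c) (≡-sym (sw-α (φ s) c))))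
      , λ ¬ch → ↦-other φ s c λ { refl → ¬ch (here (inj₁ refl)) }

-- Deletion of `F` with the vertex type left alone: only the edges at `F` disappear, so colourings
-- of both graphs have the same type.
isolate : ∀ {n} → Graph n → List (Fin n) → Graph n
isolate G F = record
  { adj = λ a b → adj G a b ∧ (not (does (a ∈?ᵛ F)) ∧ not (does (b ∈?ᵛ F)))
  ; sym = λ a b → cong₂ _∧_ (Graph.sym G a b) (𝔹.∧-comm (not (does (a ∈?ᵛ F))) _)
  ; irrefl = λ v → cong (_∧ _) (irrefl G v)
  }

module _ {n : ℕ} (G : Graph n) (F : List (Fin n)) where

  isolate⁺ : ∀ {a b} → Adj G a b → a ∉ F → b ∉ F → Adj (isolate G F) a b
  isolate⁺ {a} {b} ab a∉ b∉
    rewrite ab | dec-false (a ∈?ᵛ F) a∉ | dec-false (b ∈?ᵛ F) b∉ = refl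

  isolate⁻ : ∀ {a b} → Adj (isolate G F) a b → Adj G a b × a ∉ F × b ∉ F
  isolate⁻ {a} {b} e with adj G a b | a ∈?ᵛ F | b ∈?ᵛ F
  ... | true | no a∉ | no b∉ = refl , a∉ , b∉
  isolate⁻ {a} {b} () | true | no _ | yes _
  isolate⁻ {a} {b} () | true | yes _ | _

  reach-isolate⁺ : ∀ {P u w} → Reach G (λ x → P x × x ∉ F) u w → Reach (isolate G F) P u w
  reach-isolate⁺ (here (p , _)) = here p
  reach-isolate⁺ (step (p , u∉) a r) =
    step p (isolate⁺ a u∉ (proj₂ (reach-source r))) (reach-isolate⁺ r)

  reach-isolate⁻ : ∀ {P u w} → u ∉ F → Reach (isolate G F) P u w → Reach G (λ x → P x × x ∉ F) u w
  reach-isolate⁻ u∉ (here p) = here (p , u∉)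
  reach-isolate⁻ u∉ (step p a r) with isolate⁻ a
  ... | a′ , _ , w∉ = step (p , u∉) a′ (reach-isolate⁻ w∉ r)

-- Degenerate list assignments

-- Degree at most, respectively below, the number of colours. A list `M` that merely covers the
-- neighbours stands in for the degree, since the same `M` remains valid after edges are removed.
Bounded Slack : ∀ {n} → Graph n → ListAssignment n → Fin n → Set
Bounded G L w = ∃ λ M → (∀ {x} → Adj G w x → x ∈ M) × length M ≤ length (L w)
Slack G L w = ∃ λ M → (∀ {x} → Adj G w x → x ∈ M) × length M < length (L w)

slack⇒bounded : ∀ {n} {G : Graph n} {L : ListAssignment n} {w} → Slack G L w → Bounded G L w
slack⇒bounded (M , nbrs , lt) = M , nbrs , ≤-trans (n≤1+n _) lt

∈[x] : ∀ {A : Set} {x y : A} → y ∈ x ∷ [] → y ≡ x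
∈[x] (here e) = e

-- Lifting swaps past a slack vertex

module Simulate {n : ℕ} (G : Graph n) (L : ListAssignment n) (s : Fin n)
                (unique : Unique (L s)) (slack : Slack G L s) where

  private
    G′ : Graph n
    G′ = isolate G (s ∷ [])

    module _ {η η′ : Fin n → Colour} {α β u} (colη′ : IsLColouring G′ L η′) (b : Bi η α β u)
             (S : IsSwap G′ η η′ α β u) (u≢s : u ≢ s)
             {θ : Fin n → Colour} (colθ : IsLColouring G L θ) (agree : ∀ {w} → w ≢ s → θ w ≡ η w)
      where

      -- The first hypothesis prevents `s` from bridging two chains of `G′`, so off `s` the swap in
      -- `G` acts as in `G′`. The second keeps the colour of `s` in its list should the chain reach
      -- `s`.
      lift-swap :
        (∀ {x y} → Bi θ α β s → Adj G s x → Adj G s y → Bi θ α β x → Bi θ α β y → x ≡ y) →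
        (∀ {x} → Bi θ α β s → Adj G s x → Bi θ α β x → sw α β (θ s) ∈ L s) →
        ∃ λ θ′ → LEquivalent G L θ θ′ × (∀ {w} → w ≢ s → θ′ w ≡ η′ w)
      lift-swap single mem = θ′ , swap-≋ colθ θ′∈ bθ S′ , agree′
        where
        θ′ : Fin n → Colour
        θ′ = swapAt G θ α β u
        S′ : IsSwap G θ θ′ α β u
        S′ = swapAt-isSwap G θ α β u
        bθ : Bi θ α β u
        bθ = subst (λ c → c ≡ α ⊎ c ≡ β) (≡-sym (agree u≢s)) b
        avoid : ∀ {w} → Chain G θ α β u w → w ≢ s → Reach G (λ x → Bi θ α β x × x ≢ s) u w
        avoid r w≢s with first-hit (_≟ s) r u≢s | first-hit (_≟ s) (reach-sym r) w≢s
        ... | inj₁ r′ | _ = r′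
        ... | inj₂ _ | inj₁ r″ = reach-sym r″
        -- The first and last visits to `s` use the same neighbour, so everything between them can
        -- be cut out.
        ... | inj₂ (m , _ , r′ , a , bs , refl) | inj₂ (m′ , _ , r″ , a′ , _ , refl)
          with refl ← single bs (adj-sym G a) (adj-sym G a′)
                        (proj₁ (reach-target r′)) (proj₁ (reach-target r″))
          = reach-trans r′ (reach-sym r″)
        toG′ : ∀ {w} → Chain G θ α β u w → w ≢ s → Chain G′ η α β u w
        toG′ r w≢s = reach-isolate⁺ G (s ∷ []) (reach-map
          (λ (bx , x≢s) → subst (λ c → c ≡ α ⊎ c ≡ β) (agree x≢s) bx , x≢s ∘ ∈[x]) (avoid r w≢s))
        fromG′ : ∀ {w} → Chain G′ η α β u w → Chain G θ α β u w
        fromG′ r = reach-map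
          (λ (bx , x∉) → subst (λ c → c ≡ α ⊎ c ≡ β) (≡-sym (agree (x∉ ∘ here))) bx)
          (reach-isolate⁻ G (s ∷ []) (u≢s ∘ ∈[x]) r)
        agree′ : ∀ {w} → w ≢ s → θ′ w ≡ η′ w
        agree′ {w} w≢s with chain? G θ α β u w
        ... | yes c = trans (proj₁ (S′ w) c)
              (trans (cong (sw α β) (agree w≢s)) (≡-sym (proj₁ (S w) (toG′ c w≢s))))
        ... | no ¬c = trans (proj₂ (S′ w) ¬c)
              (trans (agree w≢s) (≡-sym (proj₂ (S w) (¬c ∘ fromG′))))
        θ′∈ : ∀ w → θ′ w ∈ L w
        θ′∈ w with w ≟ s
        ... | no w≢s = subst (_∈ L w) (≡-sym (agree′ w≢s)) (proj₂ colη′ w)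
        ... | yes refl with chain? G θ α β u s
        ...   | no ¬c = subst (_∈ L s) (≡-sym (proj₂ (S′ s) ¬c)) (proj₂ colθ s)
        ...   | yes c with first-hit (_≟ s) c u≢s
        ...     | inj₁ r = contradiction refl (proj₂ (reach-target r))
        ...     | inj₂ (m , _ , r , a , bs , refl) = subst (_∈ L s) (≡-sym (proj₁ (S′ s) c))
                    (mem bs (adj-sym G a) (proj₁ (reach-target r)))

    -- With no colour outside {α, β} left for s, the chain of s leaves s along at most one edge.
    module _ {α β} {θ : Fin n → Colour} (colθ : IsLColouring G L θ) (bs : Bi θ α β s)
             (stuck : ∀ {c} → c ∈ L s → ¬ (c ≡ α ⊎ c ≡ β) → ∃ λ x → Adj G s x × θ x ≡ c) where

      private
        M : List (Fin n)
        M = proj₁ slack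
        b : Colour
        b = sw α β (θ s)
        covered : ∀ {c} → c ∈ L s → c ≢ θ s → c ≢ b → ∃ λ x → Adj G s x × θ x ≡ c
        covered {c} c∈ c≢a c≢b = stuck c∈ λ bc → c≢b (≡-sym (sw-other bs bc (c≢a ∘ ≡-sym)))
        nbr-b : ∀ {x} → Adj G s x → Bi θ α β x → θ x ≡ b
        nbr-b a bx = ≡-sym (sw-other bs bx (proj₁ colθ _ _ a))

      -- Two such neighbours would both have colour `b`. Then `θ s`, `b` and the colours of the
      -- other members of `M` would exhaust `L s`, which has more than `length M` colours.
      stuck-single : ∀ {x y} → Adj G s x → Adj G s y → Bi θ α β x → Bi θ α β y → x ≡ y
      stuck-single {x} {y} ax ay bx by with x ≟ y
      ... | yes x≡y = x≡y
      ... | no x≢y with remove (proj₁ (proj₂ slack) ax)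
      ...   | M₁ , len₁ , keep₁ with remove (keep₁ (proj₁ (proj₂ slack) ay) (≢-sym x≢y))
      ...     | M₂ , len₂ , keep₂ = contradiction (≤-trans (proj₂ (proj₂ slack)) bound) 1+n≰n
        where
        sub : ∀ {c} → c ∈ L s → c ∈ θ s ∷ b ∷ map θ M₂
        sub {c} c∈ with c ≟ᶜ θ s | c ≟ᶜ b
        ... | yes e | _ = here e
        ... | no _ | yes e = there (here e)
        ... | no c≢a | no c≢b with covered c∈ c≢a c≢b
        ...   | z , az , refl = there (there (∈-map⁺ θ (keep₂
                (keep₁ (proj₁ (proj₂ slack) az) (λ { refl → c≢b (nbr-b ax bx) }))
                (λ { refl → c≢b (nbr-b ay by) }))))
        bound : length (L s) ≤ length M
        bound = ≤-trans (⊆⇒length≤ unique sub)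
          (≤-reflexive (trans (cong (λ k → ℕ.suc (ℕ.suc k)) (length-map θ M₂))
            (trans (cong suc (≡-sym len₂)) (≡-sym len₁))))

      -- Were `b` missing from `L s`, the neighbour `x` of colour `b` would block nothing, and `θ s`
      -- with the colours of the rest of `M` would be too few to exhaust `L s`.
      stuck-mem : ∀ {x} → Adj G s x → Bi θ α β x → b ∈ L s
      stuck-mem {x} ax bx with b ∈?ᶜ L s
      ... | yes b∈ = b∈
      ... | no b∉ with remove (proj₁ (proj₂ slack) ax)
      ...   | M₁ , len₁ , keep₁ = contradiction (≤-trans (proj₂ (proj₂ slack)) bound) 1+n≰n
        where
        sub : ∀ {c} → c ∈ L s → c ∈ θ s ∷ map θ M₁
        sub {c} c∈ with c ≟ᶜ θ s
        ... | yes e = here e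
        ... | no c≢a with covered c∈ c≢a (λ { refl → b∉ c∈ })
        ...   | z , az , refl = there (∈-map⁺ θ (keep₁ (proj₁ (proj₂ slack) az)
                λ { refl → b∉ (subst (_∈ L s) (nbr-b ax bx) c∈) }))
        bound : length (L s) ≤ length M
        bound = ≤-trans (⊆⇒length≤ unique sub)
          (≤-reflexive (trans (cong suc (length-map θ M₁)) (≡-sym len₁)))

  -- A swap at the isolated vertex `s` is ignored. Otherwise `s` is first moved to a free colour
  -- outside `α` and `β` if it has one; if it has none, counting shows that the swap lifts as it
  -- stands.
  simulate-swap : ∀ {η η′ θ} → LValidSwap G′ L η η′ → IsLColouring G L θ →
    (∀ {w} → w ≢ s → θ w ≡ η w) →
    ∃ λ θ′ → LEquivalent G L θ θ′ × (∀ {w} → w ≢ s → θ′ w ≡ η′ w)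
  simulate-swap {η} {η′} {θ} (_ , colη′ , α , β , u , b , S) colθ agree with u ≟ s
  ... | yes refl = θ , ε , λ w≢s → trans (agree w≢s) (≡-sym (proj₂ (S _) (w≢s ∘ alone)))
    where
    alone : ∀ {w} → Chain G′ η α β s w → w ≡ s
    alone = reach-closed {Q = _≡ s}
      (λ { refl a _ → contradiction (here refl) (proj₁ (proj₂ (isolate⁻ G (s ∷ []) a))) }) refl
  ... | no u≢s with bi? θ α β s
  ...   | no ¬bs = lift-swap colη′ b S u≢s colθ agree
            (λ bs → contradiction bs ¬bs) (λ bs → contradiction bs ¬bs)
  ...   | yes bs with Any.any? (λ c → ¬? ((c ≟ᶜ α) ⊎-dec (c ≟ᶜ β)) ×-dec
                                   ¬? (any? λ x → adj? G s x ×-dec (θ x ≟ᶜ c))) (L s)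
  ...     | no stuck = lift-swap colη′ b S u≢s colθ agree
              (λ _ → stuck-single colθ bs stuck′) (λ _ → stuck-mem colθ bs stuck′)
    where
    stuck′ : ∀ {c} → c ∈ L s → ¬ (c ≡ α ⊎ c ≡ β) → ∃ λ x → Adj G s x × θ x ≡ c
    stuck′ {c} c∈ c∉ with any? (λ x → adj? G s x ×-dec (θ x ≟ᶜ c))
    ... | yes found = found
    ... | no none = contradiction (lose c∈ (c∉ , none)) stuck
  ...     | yes free with find free
  ...       | c , c∈ , c∉ , none
    with recolour colθ c∈ (λ a e → none (_ , a , e))
  ...         | col₁ , θ≋θ₁
    with lift-swap colη′ b S u≢s col₁ (λ w≢s → trans (↦-other θ s c w≢s) (agree w≢s))
           (λ bs₁ → contradiction (subst (λ d → d ≡ α ⊎ d ≡ β) (↦-same θ s c) bs₁) c∉)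
           (λ bs₁ → contradiction (subst (λ d → d ≡ α ⊎ d ≡ β) (↦-same θ s c) bs₁) c∉)
  ...           | θ′ , θ₁≋θ′ , agree′ = θ′ , θ≋θ₁ ◅◅ θ₁≋θ′ , agree′

  simulate : ∀ {η η′ θ} → LEquivalent G′ L η η′ → IsLColouring G L θ →
    (∀ {w} → w ≢ s → θ w ≡ η w) →
    ∃ λ θ′ → LEquivalent G L θ θ′ × (∀ {w} → w ≢ s → θ′ w ≡ η′ w)
  simulate ε _ agree = _ , ε , agree
  simulate (v ◅ vs) colθ agree with simulate-swap v colθ agree
  ... | θ₁ , θ≋θ₁ , agree₁ with simulate vs (≋-col colθ θ≋θ₁) agree₁
  ...   | θ₂ , θ₁≋θ₂ , agree₂ = θ₂ , θ≋θ₁ ◅◅ θ₁≋θ₂ , agree₂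

free-colour : ∀ {n} {G : Graph n} {L : ListAssignment n} {s} (φ : Fin n → Colour) →
  Unique (L s) → Slack G L s → ∃ λ c → c ∈ L s × (∀ {x} → Adj G s x → φ x ≢ c)
free-colour {L = L} {s} φ unique (M , nbrs , len) with Any.any? (λ c → ¬? (c ∈?ᶜ map φ M)) (L s)
... | yes free = let c , c∈ , c∉ = find free in
      c , c∈ , λ a e → c∉ (subst (_∈ map φ M) e (∈-map⁺ φ (nbrs a)))
... | no none = contradiction (≤-trans len (≤-trans (⊆⇒length≤ unique sub) (≤-reflexive (length-map φ M)))) 1+n≰n
  where
  sub : ∀ {c} → c ∈ L s → c ∈ map φ M
  sub {c} c∈ with c ∈?ᶜ map φ M
  ... | yes c∈M = c∈M
  ... | no c∉M = contradiction (lose c∈ c∉M) none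

nonempty : ∀ {A : Set} {k} {xs : List A} → k < length xs → ∃ (_∈ xs)
nonempty {xs = x ∷ _} _ = x , here refl

-- Isolating a slack vertex s makes its neighbours slack; W is the set of vertices not yet isolated.
degenerate : ∀ {n} k (W : List (Fin n)) → length W ≤ k → (G : Graph n) (L : ListAssignment n) →
  (∀ v → Unique (L v)) → (∀ v → Bounded G L v) →
  (∀ v → ∃ λ s → Slack G L s × Reach G (λ _ → ⊤) v s) →
  (∀ {a b} → Adj G a b → a ∈ W) →
  ∃ (IsLColouring G L) ×
  (∀ φ ψ → IsLColouring G L φ → IsLColouring G L ψ →
    ∃ λ θ → LEquivalent G L φ θ × (∀ {w} → w ∈ W → θ w ≡ ψ w))
-- With `W` empty there are no edges: every vertex is itself slack, so its list is nonempty, and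
-- agreement on `W` is vacuous.
degenerate k [] _ G L unique bounded slack edges =
  ((λ v → proj₁ (pick v)) , (λ u v a → case edges a of λ ()) , λ v → proj₂ (pick v)) ,
  λ φ ψ _ _ → φ , ε , λ ()
  where
  pick : ∀ v → ∃ (_∈ L v)
  pick v with slack v
  ... | _ , (_ , _ , len) , here _ = nonempty len
  ... | _ , _ , step _ a _ = case edges a of λ ()
degenerate {n} (suc k) W@(w₀ ∷ _) len G L unique bounded slack edges with slack w₀
... | s , slack-s , path = existence , connecting
  where
  open Simulate G L s (unique s) slack-s
  G′ : Graph n
  G′ = isolate G (s ∷ [])
  ≢s? : Decidable (_≢ s)
  ≢s? w = ¬? (w ≟ s)
  W′ : List (Fin n)
  W′ = filter ≢s? W
  s∈W : s ∈ W
  s∈W with reach-sym path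
  ... | here _ = here refl
  ... | step _ a _ = edges a
  adj⁻ : ∀ {a b} → Adj G′ a b → Adj G a b × a ≢ s × b ≢ s
  adj⁻ a with isolate⁻ G (s ∷ []) a
  ... | e , x , y = e , x ∘ here , y ∘ here
  len′ : length W′ ≤ k
  len′ = ≤-pred (≤-trans
    (filter-notAll ≢s? W (Any.map (λ s≡w w≢s → w≢s (≡-sym s≡w)) s∈W)) len)
  bounded′ : ∀ v → Bounded G′ L v
  bounded′ v with bounded v
  ... | M , nbrs , le = M , (λ a → nbrs (proj₁ (adj⁻ a))) , le
  slack′ : ∀ v → ∃ λ t → Slack G′ L t × Reach G′ (λ _ → ⊤) v t
  slack′ v with v ≟ s
  ... | yes refl = s , ([] , (λ a → contradiction refl (proj₁ (proj₂ (adj⁻ a)))) ,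
          ≤-trans (s≤s z≤n) (proj₂ (proj₂ slack-s))) , here tt
  ... | no v≢s with slack v
  ...   | t , (M , nbrs , lt) , r with first-hit (_≟ s) r v≢s
  ...     | inj₁ r′ = t , (M , (λ a → nbrs (proj₁ (adj⁻ a))) , lt) ,
              reach-isolate⁺ G _ (reach-map (λ (_ , x≢s) → tt , x≢s ∘ ∈[x]) r′)
  ...     | inj₂ (m , _ , r′ , a , _ , refl) with bounded m
  ...       | M′ , nbrs′ , le with remove (nbrs′ a)
  ...         | M″ , lenM , keep = m ,
                  (M″ , (λ a′ → keep (nbrs′ (proj₁ (adj⁻ a′))) (proj₂ (proj₂ (adj⁻ a′)))) ,
                    ≤-trans (≤-reflexive (≡-sym lenM)) le) ,
                  reach-isolate⁺ G _ (reach-map (λ (_ , x≢s) → tt , x≢s ∘ ∈[x]) r′)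
  edges′ : ∀ {a b} → Adj G′ a b → a ∈ W′
  edges′ a with adj⁻ a
  ... | e , a≢s , _ = ∈-filter⁺ ≢s? (edges e) a≢s
  colour′ : ∀ {φ} → IsLColouring G L φ → IsLColouring G′ L φ
  colour′ (pr , ∈L) = (λ u v a → pr u v (proj₁ (adj⁻ a))) , ∈L
  IH = degenerate k W′ len′ G′ L unique bounded′ slack′ edges′
  existence : ∃ (IsLColouring G L)
  existence with proj₁ IH
  ... | η , pr , ∈L with free-colour {G = G} {L} η (unique s) slack-s
  ...   | c , c∈ , free = φ , proper , ∈L′
    where
    φ : Fin n → Colour
    φ = η [ s ↦ c ]
    proper : Proper G φ
    proper u v a with u ≟ s | v ≟ s
    ... | yes refl | yes refl = contradiction refl (adj⇒≢ G a)
    ... | yes refl | no _ = λ e → free a (≡-sym e)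
    ... | no _ | yes refl = free (adj-sym G a)
    ... | no u≢s | no v≢s = pr u v (isolate⁺ G _ a (u≢s ∘ ∈[x]) (v≢s ∘ ∈[x]))
    ∈L′ : ∀ v → φ v ∈ L v
    ∈L′ v with v ≟ s
    ... | yes refl = c∈
    ... | no _ = ∈L v
  connecting : ∀ φ ψ → IsLColouring G L φ → IsLColouring G L ψ →
    ∃ λ θ → LEquivalent G L φ θ × (∀ {w} → w ∈ W → θ w ≡ ψ w)
  connecting φ ψ cφ cψ with proj₂ IH φ ψ (colour′ cφ) (colour′ cψ)
  ... | η , φ≋η , agree with simulate φ≋η cφ (λ _ → refl)
  -- The neighbours of `s` already have their colours under `ψ`, so `ψ s` is free at `s`.
  ...   | θ , φ≋θ , agree′ with recolour (≋-col cφ φ≋θ) (proj₂ cψ s) off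
    where
    on-W′ : ∀ {w} → w ∈ W → w ≢ s → θ w ≡ ψ w
    on-W′ w∈ w≢s = trans (agree′ w≢s) (agree (∈-filter⁺ ≢s? w∈ w≢s))
    off : ∀ {x} → Adj G s x → θ x ≢ ψ s
    off {x} a e = proj₁ cψ x s (adj-sym G a)
      (trans (≡-sym (on-W′ (edges (adj-sym G a)) (≢-sym (adj⇒≢ G a)))) e)
  ...     | _ , θ≋θ′ = θ [ s ↦ ψ s ] , φ≋θ ◅◅ θ≋θ′ , final
    where
    final : ∀ {w} → w ∈ W → (θ [ s ↦ ψ s ]) w ≡ ψ w
    final {w} w∈ with w ≟ s
    ... | yes refl = refl
    ... | no w≢s = trans (agree′ w≢s) (agree (∈-filter⁺ ≢s? w∈ w≢s))

-- Colourings with prescribed values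

module Pinned {n : ℕ} (G : Graph n) (L : ListAssignment n)
  (unique : ∀ v → Unique (L v)) (bounded : ∀ v → Bounded G L v)
  (F : List (Fin n)) (κ : Fin n → Colour)
  (κ-proper : ∀ {f g} → f ∈ F → g ∈ F → Adj G f g → κ f ≢ κ g)
  (κ∈ : ∀ {f} → f ∈ F → κ f ∈ L f) where

  -- In both alternatives one pinned neighbour of `t` takes no colour from its list beyond what the
  -- other pinned neighbours take.
  PinSlack : Fin n → Set
  PinSlack t = (∃ λ f → f ∈ F × Adj G t f × κ f ∉ L t) ⊎
    (∃ λ f → ∃ λ g → f ∈ F × g ∈ F × f ≢ g × Adj G t f × Adj G t g × κ f ≡ κ g)

  private
    Clash : Fin n → Colour → Set
    Clash w c = ∃ λ f → f ∈ F × Adj G w f × κ f ≡ c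

    clash? : ∀ w → Decidable (Clash w)
    clash? w c = any? λ f → f ∈?ᵛ F ×-dec (adj? G w f ×-dec (κ f ≟ᶜ c))

    G′ : Graph n
    G′ = isolate G F

    -- Singletons on `F` make the colourings of `G′` from `L′` exactly the colourings of `G` from
    -- `L` that agree with `κ` on `F`; see `col⁻` and `col⁺`.
    L′ : ListAssignment n
    L′ w = if does (w ∈?ᵛ F) then κ w ∷ [] else filter (¬? ∘ clash? w) (L w)

    L′-pinned : ∀ {w} → w ∈ F → L′ w ≡ κ w ∷ []
    L′-pinned {w} = proj₁ (if-dec (w ∈?ᵛ F))

    L′-free : ∀ {w} → w ∉ F → L′ w ≡ filter (¬? ∘ clash? w) (L w)
    L′-free {w} = proj₂ (if-dec (w ∈?ᵛ F))

    unique′ : ∀ v → Unique (L′ v)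
    unique′ v with v ∈?ᵛ F
    ... | yes _ = [] ∷ []
    ... | no _ = Unique.filter⁺ (¬? ∘ clash? v) (unique v)

    ∈L′⁺ : ∀ {w c} → w ∉ F → c ∈ L w → ¬ Clash w c → c ∈ L′ w
    ∈L′⁺ {w} w∉ c∈ ¬cl = subst (_ ∈_) (≡-sym (L′-free w∉)) (∈-filter⁺ (¬? ∘ clash? w) c∈ ¬cl)

    ∈L′⁻ : ∀ {w c} → w ∉ F → c ∈ L′ w → c ∈ L w × ¬ Clash w c
    ∈L′⁻ {w} w∉ c∈ = ∈-filter⁻ (¬? ∘ clash? w) {xs = L w} (subst (_ ∈_) (L′-free w∉) c∈)

    free pinned : List (Fin n) → List (Fin n)
    free = filter (¬? ∘ (_∈?ᵛ F))
    pinned = filter (_∈?ᵛ F)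

    -- Each colour that `w` loses is charged to a member of `fs`. All pinned neighbours suffice for
    -- boundedness; leaving out a redundant one yields slack.
    cover : ∀ {w} → w ∉ F → (fs : List (Fin n)) →
      (∀ {c} → c ∈ L w → Clash w c → c ∈ map κ fs) → length (L w) ≤ length (L′ w) ℕ.+ length fs
    cover {w} w∉ fs cl = ≤-trans (⊆⇒length≤ (unique w) sub)
      (≤-reflexive (trans (length-++ (L′ w)) (cong (length (L′ w) ℕ.+_) (length-map κ fs))))
      where
      sub : ∀ {c} → c ∈ L w → c ∈ L′ w ++ map κ fs
      sub {c} c∈ with clash? w c
      ... | yes k = ∈-++⁺ʳ (L′ w) (cl c∈ k)
      ... | no ¬k = ∈-++⁺ˡ (∈L′⁺ w∉ c∈ ¬k)

    free-nbrs : ∀ {w M} → (∀ {x} → Adj G w x → x ∈ M) → ∀ {x} → Adj G′ w x → x ∈ free M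
    free-nbrs nbrs a with isolate⁻ G F a
    ... | a′ , _ , x∉ = ∈-filter⁺ (¬? ∘ (_∈?ᵛ F)) (nbrs a′) x∉

    pinned-nbrs : ∀ {w M} → (∀ {x} → Adj G w x → x ∈ M) → ∀ {f} → Adj G w f → f ∈ F → f ∈ pinned M
    pinned-nbrs nbrs a f∈ = ∈-filter⁺ (_∈?ᵛ F) (nbrs a) f∈

    slack-pinned : ∀ {w} → w ∈ F → Slack G′ L′ w
    slack-pinned w∈ = [] , (λ a → contradiction w∈ (proj₁ (proj₂ (isolate⁻ G F a)))) ,
      ≤-reflexive (cong length (≡-sym (L′-pinned w∈)))

    bounded-free : ∀ {w} → w ∉ F → Bounded G′ L′ w
    bounded-free {w} w∉ with bounded w
    ... | M , nbrs , le = free M , free-nbrs nbrs ,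
      +-cancelʳ-≤ (length (pinned M)) _ _ (≤-trans (≤-reflexive (filter-length-split (_∈?ᵛ F) M))
        (≤-trans le (cover w∉ (pinned M) λ where
          _ (f , f∈ , a , refl) → ∈-map⁺ κ (pinned-nbrs nbrs a f∈))))

    slack-redundant : ∀ {w f} → w ∉ F → f ∈ F → Adj G w f →
      (∀ {c} → c ∈ L w → Clash w c → ∃ λ g → g ∈ F × Adj G w g × κ g ≡ c × g ≢ f) → Slack G′ L′ w
    slack-redundant {w} {f} w∉ f∈ a other with bounded w
    ... | M , nbrs , le with remove (pinned-nbrs nbrs a f∈)
    ...   | fs , len , keep = free M , free-nbrs nbrs ,
      +-cancelʳ-≤ (length fs) _ _ (≤-trans (≤-reflexive (trans (≡-sym (+-suc _ _))
        (trans (cong (length (free M) ℕ.+_) (≡-sym len)) (filter-length-split (_∈?ᵛ F) M))))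
        (≤-trans le (cover w∉ fs λ c∈ k → case other c∈ k of λ where
          (g , g∈ , ag , refl , g≢f) → ∈-map⁺ κ (keep (pinned-nbrs nbrs ag g∈) g≢f))))

    pinSlack⇒slack : ∀ {t} → t ∉ F → PinSlack t → Slack G′ L′ t
    pinSlack⇒slack t∉ (inj₁ (f , f∈ , a , κ∉)) = slack-redundant t∉ f∈ a λ where
      c∈ (g , g∈ , ag , refl) → g , g∈ , ag , refl , λ { refl → κ∉ c∈ }
    pinSlack⇒slack t∉ (inj₂ (f , f′ , f∈ , f′∈ , f≢f′ , a , a′ , e)) = slack-redundant t∉ f∈ a λ where
      c∈ (g , g∈ , ag , refl) → case g ≟ f of λ where
        (yes refl) → f′ , f′∈ , a′ , ≡-sym e , ≢-sym f≢f′
        (no g≢f) → g , g∈ , ag , refl , g≢f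

    col⁻ : ∀ {η} → IsLColouring G′ L′ η → IsLColouring G L η × (∀ {f} → f ∈ F → η f ≡ κ f)
    col⁻ {η} (pr , ∈L′) = (proper , ∈L) , on-F
      where
      on-F : ∀ {f} → f ∈ F → η f ≡ κ f
      on-F {f} f∈ = ∈[x] (subst (η f ∈_) (L′-pinned f∈) (∈L′ f))
      ∈L : ∀ v → η v ∈ L v
      ∈L v with v ∈?ᵛ F
      ... | yes v∈ = subst (_∈ L v) (≡-sym (on-F v∈)) (κ∈ v∈)
      ... | no v∉ = proj₁ (∈L′⁻ v∉ (∈L′ v))
      proper : Proper G η
      proper u v a e with u ∈?ᵛ F | v ∈?ᵛ F
      ... | yes u∈ | yes v∈ = κ-proper u∈ v∈ a (trans (≡-sym (on-F u∈)) (trans e (on-F v∈)))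
      ... | yes u∈ | no v∉ =
            proj₂ (∈L′⁻ v∉ (∈L′ v)) (u , u∈ , adj-sym G a , trans (≡-sym (on-F u∈)) e)
      ... | no u∉ | yes v∈ =
            proj₂ (∈L′⁻ u∉ (∈L′ u)) (v , v∈ , a , trans (≡-sym (on-F v∈)) (≡-sym e))
      ... | no u∉ | no v∉ = pr u v (isolate⁺ G F a u∉ v∉) e

    col⁺ : ∀ {η} → IsLColouring G L η → (∀ {f} → f ∈ F → η f ≡ κ f) → IsLColouring G′ L′ η
    col⁺ {η} (pr , ∈L) on-F = (λ u v a → pr u v (proj₁ (isolate⁻ G F a))) , ∈L′
      where
      ∈L′ : ∀ v → η v ∈ L′ v
      ∈L′ v with v ∈?ᵛ F
      ... | yes v∈ = here (on-F v∈)
      ... | no v∉ = ∈-filter⁺ (¬? ∘ clash? v) (∈L v) λ where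
            (f , f∈ , a , e) → pr v f a (trans (≡-sym e) (≡-sym (on-F f∈)))

    -- The chain in `G` cannot run into `F`: the last vertex before `F` would receive, in the swap
    -- of `G′`, the colour of its pinned neighbour, which `L′` has struck from its list. So both
    -- chains coincide. A swap at a pinned vertex changes nothing.
    lift-pinned : ∀ {η η′} → LValidSwap G′ L′ η η′ → LEquivalent G L η η′
    lift-pinned {η} {η′} (c , c′@(_ , ∈L′) , α , β , u , b , S) with u ∈?ᵛ F
    ... | yes u∈ = pointwise-≋ u (proj₁ (col⁻ c)) same
      where
      alone : ∀ {w} → Chain G′ η α β u w → w ≡ u
      alone = reach-closed {Q = _≡ u}
        (λ { refl a _ → contradiction u∈ (proj₁ (proj₂ (isolate⁻ G F a))) }) refl
      same : ∀ w → η w ≡ η′ w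
      same w with w ≟ u
      ... | yes refl = trans (proj₂ (col⁻ c) u∈) (≡-sym (proj₂ (col⁻ c′) u∈))
      ... | no w≢u = ≡-sym (proj₂ (S w) (w≢u ∘ alone))
    ... | no u∉ = swap-≋ (proj₁ (col⁻ c)) (proj₂ (proj₁ (col⁻ c′))) b λ v →
        (λ ch → proj₁ (S v) (toG′ ch)) , λ ¬ch → proj₂ (S v) (¬ch ∘ fromG′)
      where
      fromG′ : ∀ {w} → Chain G′ η α β u w → Chain G η α β u w
      fromG′ r = reach-map proj₁ (reach-isolate⁻ G F u∉ r)
      toG′ : ∀ {w} → Chain G η α β u w → Chain G′ η α β u w
      toG′ ch with first-hit (_∈?ᵛ F) ch u∉
      ... | inj₁ r = reach-isolate⁺ G F r
      ... | inj₂ (m , q , r , a , bq , q∈) = ⊥-elim (proj₂ (∈L′⁻ m∉ (∈L′ m))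
              (q , q∈ , a , trans (≡-sym (proj₂ (col⁻ c) q∈))
                (≡-sym (trans (proj₁ (S m) (reach-isolate⁺ G F r))
                  (sw-other bm bq (proj₁ (proj₁ (col⁻ c)) m q a))))))
        where
        bm : Bi η α β m
        bm = proj₁ (reach-target r)
        m∉ : m ∉ F
        m∉ = proj₂ (reach-target r)

    lift-pinned* : ∀ {η η′} → LEquivalent G′ L′ η η′ → LEquivalent G L η η′
    lift-pinned* ε = ε
    lift-pinned* (v ◅ vs) = lift-pinned v ◅◅ lift-pinned* vs

  module _ (slack : ∀ {w} → w ∉ F → ∃ λ t → PinSlack t × Reach G (_∉ F) w t) where

    private
      slack′ : ∀ v → ∃ λ t → Slack G′ L′ t × Reach G′ (λ _ → ⊤) v t
      slack′ v = case v ∈?ᵛ F of λ where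
        (yes v∈) → v , slack-pinned v∈ , here tt
        (no v∉) → case slack v∉ of λ where
          (t , ps , r) → t , pinSlack⇒slack (reach-target r) ps ,
            reach-isolate⁺ G F (reach-map (tt ,_) r)
      bounded′ : ∀ v → Bounded G′ L′ v
      bounded′ v = case v ∈?ᵛ F of λ where
        (no v∉) → bounded-free v∉
        (yes v∈) → slack⇒bounded {G = G′} {L′} {v} (slack-pinned v∈)
      main = degenerate _ (allFin n) ≤-refl G′ L′ unique′ bounded′ slack′ (λ _ → ∈-allFin _)

    pinned-exists : ∃ λ φ → IsLColouring G L φ × (∀ {f} → f ∈ F → φ f ≡ κ f)
    pinned-exists = proj₁ (proj₁ main) , col⁻ (proj₂ (proj₁ main))

    pinned-≋ : Fin n → ∀ {φ ψ} → IsLColouring G L φ → IsLColouring G L ψ →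
      (∀ {f} → f ∈ F → φ f ≡ κ f) → (∀ {f} → f ∈ F → ψ f ≡ κ f) → LEquivalent G L φ ψ
    pinned-≋ u cφ cψ φF ψF with proj₂ main _ _ (col⁺ cφ φF) (col⁺ cψ ψF)
    ... | θ , φ≋θ , agree = let φ≋θ′ = lift-pinned* φ≋θ in
      φ≋θ′ ◅◅ pointwise-≋ u (≋-col cφ φ≋θ′) (λ w → agree (∈-allFin w))

-- Cubic graphs

record N3 {n : ℕ} (G : Graph n) (v x y z : Fin n) : Set where
  field
    ax : Adj G v x
    ay : Adj G v y
    az : Adj G v z
    x≢y : x ≢ y
    x≢z : x ≢ z
    y≢z : y ≢ z
    all : ∀ {w} → Adj G v w → w ≡ x ⊎ w ≡ y ⊎ w ≡ z

N3-swap₂₃ : ∀ {n} {G : Graph n} {v x y z} → N3 G v x y z → N3 G v x z y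
N3-swap₂₃ N = record { ax = ax ; ay = az ; az = ay ; x≢y = x≢z ; x≢z = x≢y ; y≢z = ≢-sym y≢z
  ; all = λ a → case all a of λ where
      (inj₁ e) → inj₁ e
      (inj₂ (inj₁ e)) → inj₂ (inj₂ e)
      (inj₂ (inj₂ e)) → inj₂ (inj₁ e) }
  where open N3 N

N3-swap₁₂ : ∀ {n} {G : Graph n} {v x y z} → N3 G v x y z → N3 G v y x z
N3-swap₁₂ N = record { ax = ay ; ay = ax ; az = az ; x≢y = ≢-sym x≢y ; x≢z = y≢z ; y≢z = x≢z
  ; all = λ a → case all a of λ where
      (inj₁ e) → inj₂ (inj₁ e)
      (inj₂ (inj₁ e)) → inj₁ e
      (inj₂ (inj₂ e)) → inj₂ (inj₂ e) }
  where open N3 N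

N3-rot : ∀ {n} {G : Graph n} {v x y z} → N3 G v x y z → N3 G v y z x
N3-rot N = N3-swap₂₃ (N3-swap₁₂ N)

count-tabulate : ∀ {m} {A : Set} (p : A → Bool) (g : Fin m → A) →
  ∣ Vec.tabulate (p ∘ g) ∣ ≡ length (filter (λ w → p w 𝔹.≟ true) (List.tabulate g))
count-tabulate {zero} p g = refl
count-tabulate {suc m} p g with p (g zero)
... | true = cong suc (count-tabulate p (g ∘ suc))
... | false = count-tabulate p (g ∘ suc)

cubic-nbhd : ∀ {n} (G : Graph n) → Regular G 3 → ∀ v → ∃ λ x → ∃ λ y → ∃ λ z → N3 G v x y z
cubic-nbhd {n} G reg v = extract nbrs
    (trans (≡-sym (count-tabulate (adj G v) id)) (reg v))
    (Unique.filter⁺ nbr? (Unique.allFin⁺ n))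
    (λ w∈ → proj₂ (∈-filter⁻ nbr? {xs = allFin n} w∈))
    (λ a → ∈-filter⁺ nbr? (∈-allFin _) a)
  where
  nbr? : Decidable (Adj G v)
  nbr? w = adj G v w 𝔹.≟ true
  nbrs : List (Fin n)
  nbrs = filter nbr? (allFin n)
  extract : ∀ xs → length xs ≡ 3 → Unique xs → (∀ {w} → w ∈ xs → Adj G v w) →
    (∀ {w} → Adj G v w → w ∈ xs) → ∃ λ x → ∃ λ y → ∃ λ z → N3 G v x y z
  extract (x ∷ y ∷ z ∷ []) refl ((x≢y ∷ x≢z ∷ []) ∷ (y≢z ∷ []) ∷ _) sound complete =
    x , y , z , record
      { ax = sound (here refl) ; ay = sound (there (here refl)) ; az = sound (there (there (here refl)))
      ; x≢y = x≢y ; x≢z = x≢z ; y≢z = y≢z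
      ; all = λ a → case complete a of λ where
          (here e) → inj₁ e
          (there (here e)) → inj₂ (inj₁ e)
          (there (there (here e))) → inj₂ (inj₂ e) }

∣⁅a⁆∪p∣≤1+∣p∣ : ∀ {n} (a : Fin n) (p : Subset n) → ∣ ⁅ a ⁆ ∪ p ∣ ≤ suc ∣ p ∣
∣⁅a⁆∪p∣≤1+∣p∣ zero (true Vec.∷ p) rewrite ∪-identityˡ p = n≤1+n _
∣⁅a⁆∪p∣≤1+∣p∣ zero (false Vec.∷ p) rewrite ∪-identityˡ p = ≤-refl
∣⁅a⁆∪p∣≤1+∣p∣ (suc a) (true Vec.∷ p) = s≤s (∣⁅a⁆∪p∣≤1+∣p∣ a p)
∣⁅a⁆∪p∣≤1+∣p∣ (suc a) (false Vec.∷ p) = ∣⁅a⁆∪p∣≤1+∣p∣ a p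

module _ {n : ℕ} (G : Graph n) (conn : KConnected G 3) where

  -- Coinciding `a` and `b` are allowed, which is how a single vertex gets deleted later on.
  minus-two : ∀ a b {u v} → u ≢ a → u ≢ b → v ≢ a → v ≢ b → Reach G (λ w → w ≢ a × w ≢ b) u v
  minus-two a b {u} {v} u≢a u≢b v≢a v≢b = reach-map (λ w∉ → (λ { refl → w∉ a∈ }) , λ { refl → w∉ b∈ })
      (proj₂ (conn S small) u v (out u≢a u≢b) (out v≢a v≢b))
    where
    S : Subset n
    S = ⁅ a ⁆ ∪ ⁅ b ⁆
    a∈ : a Sub.∈ S
    a∈ = x∈p∪q⁺ (inj₁ (x∈⁅x⁆ a))
    b∈ : b Sub.∈ S
    b∈ = x∈p∪q⁺ (inj₂ (x∈⁅x⁆ b))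
    small : ∣ S ∣ < 3
    small = s≤s (≤-trans (∣⁅a⁆∪p∣≤1+∣p∣ a ⁅ b ⁆) (s≤s (≤-reflexive (∣⁅x⁆∣≡1 b))))
    out : ∀ {w} → w ≢ a → w ≢ b → w Sub.∉ S
    out w≢a w≢b w∈ with x∈p∪q⁻ ⁅ a ⁆ ⁅ b ⁆ w∈
    ... | inj₁ p = w≢a (x∈⁅y⁆⇒x≡y a p)
    ... | inj₂ p = w≢b (x∈⁅y⁆⇒x≡y b p)

module Cubic {n : ℕ} (G : Graph n) (L : ListAssignment n)
  (reg : Regular G 3) (conn : KConnected G 3) (assign : IsKAssignment 3 L) where

  Col : (Fin n → Colour) → Set
  Col = IsLColouring G L

  infix 4 _≋_ _~_ _≁_
  _≋_ : (φ ψ : Fin n → Colour) → Set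
  _≋_ = LEquivalent G L

  _~_ _≁_ : Fin n → Fin n → Set
  _~_ = Adj G
  u ≁ v = ¬ Adj G u v

  ~-sym : ∀ {u v} → u ~ v → v ~ u
  ~-sym = adj-sym G

  ~⇒≢ : ∀ {u v} → u ~ v → u ≢ v
  ~⇒≢ = adj⇒≢ G

  nbhd : ∀ v → ∃ λ x → ∃ λ y → ∃ λ z → N3 G v x y z
  nbhd = cubic-nbhd G reg

  nbhd-with₁ : ∀ {v x} → v ~ x → ∃ λ y → ∃ λ z → N3 G v x y z
  nbhd-with₁ {v} a with nbhd v
  ... | x , y , z , N with N3.all N a
  ...   | inj₁ refl = y , z , N
  ...   | inj₂ (inj₁ refl) = x , z , N3-swap₁₂ N
  ...   | inj₂ (inj₂ refl) = x , y , N3-rot (N3-rot N)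

  nbhd-with₂ : ∀ {v x y} → v ~ x → v ~ y → x ≢ y → ∃ λ z → N3 G v x y z
  nbhd-with₂ a b x≢y with nbhd-with₁ a
  ... | y , z , N with N3.all N b
  ...   | inj₁ e = contradiction (≡-sym e) x≢y
  ...   | inj₂ (inj₁ refl) = z , N
  ...   | inj₂ (inj₂ refl) = y , N3-swap₂₃ N

  nbhd-with₃ : ∀ {v x y z} → v ~ x → v ~ y → v ~ z → x ≢ y → x ≢ z → y ≢ z → N3 G v x y z
  nbhd-with₃ p q r xy xz yz with nbhd-with₂ p q xy
  ... | _ , N with N3.all N r
  ...   | inj₁ e = contradiction (≡-sym e) xz
  ...   | inj₂ (inj₁ e) = contradiction (≡-sym e) yz
  ...   | inj₂ (inj₂ refl) = N

  unique : ∀ v → Unique (L v)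
  unique v = proj₁ (assign v)

  bounded : ∀ v → Bounded G L v
  bounded v with nbhd v
  ... | x , y , z , N = x ∷ y ∷ z ∷ [] , (λ a → case N3.all N a of λ where
          (inj₁ e) → here e
          (inj₂ (inj₁ e)) → there (here e)
          (inj₂ (inj₂ e)) → there (there (here e))) , ≤-reflexive (≡-sym (proj₂ (assign v)))

  connected₂ : ∀ a b {u v} → u ≢ a → u ≢ b → v ≢ a → v ≢ b → Reach G (λ w → w ≢ a × w ≢ b) u v
  connected₂ = minus-two G conn

  connected : ∀ u v → Reach G (λ _ → ⊤) u v
  connected u v with u ≟ v
  ... | yes refl = here tt
  ... | no _ with nbhd u
  ...   | x , y , z , N with x ≟ v | y ≟ v
  ...     | yes refl | _ = step tt (N3.ax N) (here tt)
  ...     | no _ | yes refl = step tt (N3.ay N) (here tt)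
  ...     | no x≢v | no y≢v = step tt (N3.ax N) (reach-map _
              (connected₂ y y (N3.x≢y N) (N3.x≢y N) (≢-sym y≢v) (≢-sym y≢v)))

-- Lists that are not all equal

  module Unequal where

    -- Colouring u with α leaves v with three colours for two neighbours.
    Special : Fin n → Fin n → Colour → Set
    Special u v α = u ~ v × α ∈ L u × α ∉ L v

    -- Both lists have three colours; if `L v` were contained in `L u`, it would fit into `L u`
    -- without `α`.
    exchange : ∀ {u v α} → α ∈ L u → α ∉ L v → ∃ λ δ → δ ∈ L v × δ ∉ L u
    exchange {u} {v} {α} α∈ α∉ with Any.any? (λ c → ¬? (c ∈?ᶜ L u)) (L v)
    ... | yes found = find found
    ... | no none with remove α∈
    ...   | M , len , keep = contradiction (≤-trans (≤-reflexive (trans (≡-sym len)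
              (trans (proj₂ (assign u)) (≡-sym (proj₂ (assign v)))))) (⊆⇒length≤ (unique v) sub)) 1+n≰n
      where
      sub : ∀ {c} → c ∈ L v → c ∈ M
      sub {c} c∈ with c ∈?ᶜ L u
      ... | yes c∈u = keep c∈u λ { refl → α∉ c∈ }
      ... | no c∉u = contradiction (lose c∈ c∉u) none

    Joined : Fin n → Colour → Fin n → Colour → Set
    Joined u α u′ α′ = ∀ {φ ψ} → Col φ → Col ψ → φ u ≡ α → ψ u′ ≡ α′ → φ ≋ ψ

    joined-sym : ∀ {u α u′ α′} → Joined u α u′ α′ → Joined u′ α′ u α
    joined-sym J cφ cψ e e′ = ≋-sym (J cψ cφ e′ e)

    module _ {u v α} (T : Special u v α) where

      private
        u~v : u ~ v
        u~v = proj₁ T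
        α-proper : ∀ {f g} → f ∈ u ∷ [] → g ∈ u ∷ [] → f ~ g → α ≢ α
        α-proper (here refl) (here refl) a = contradiction refl (~⇒≢ a)
        α∈ : ∀ {f} → f ∈ u ∷ [] → α ∈ L f
        α∈ (here refl) = proj₁ (proj₂ T)
        module P = Pinned G L unique bounded (u ∷ []) (λ _ → α) α-proper α∈
        slack : ∀ {w} → w ∉ u ∷ [] → ∃ λ t → P.PinSlack t × Reach G (_∉ u ∷ []) w t
        slack w∉ = v , inj₁ (u , here refl , ~-sym u~v , proj₂ (proj₂ T)) ,
          reach-map (λ (w≢u , _) → w≢u ∘ ∈[x])
            (connected₂ u u (w∉ ∘ here) (w∉ ∘ here) (≢-sym (~⇒≢ u~v)) (≢-sym (~⇒≢ u~v)))

      special-exists : ∃ λ φ → Col φ × φ u ≡ α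
      special-exists with P.pinned-exists slack
      ... | φ , c , e = φ , c , e (here refl)

      special-joined : Joined u α u α
      special-joined cφ cψ e e′ = P.pinned-≋ slack u cφ cψ (λ { (here refl) → e }) (λ { (here refl) → e′ })

    joined-trans : ∀ {u α u′ v′ α′ u″ α″} → Special u′ v′ α′ →
      Joined u α u′ α′ → Joined u′ α′ u″ α″ → Joined u α u″ α″
    joined-trans T J J′ cφ cψ e e″ with special-exists T
    ... | χ , cχ , e′ = J cφ cχ e e′ ◅◅ J′ cχ cψ e′ e″

    -- Both vertices are pinned at once. The remainder is connected, so one redundant colour is
    -- enough, and `witness` says that `v` or `v′` is not itself pinned. The resulting colouring
    -- lies in both classes.
    link : ∀ {u v α u′ v′ α′} → Special u v α → Special u′ v′ α′ →
      u ≢ u′ → (u ~ u′ → α ≢ α′) → v ≢ u′ ⊎ v′ ≢ u → Joined u α u′ α′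
    link {u} {v} {α} {u′} {v′} {α′} T T′ u≢u′ α≢α′ witness cφ cψ e e′ with P.pinned-exists slack
      where
      F : List (Fin n)
      F = u ∷ u′ ∷ []
      κ : Fin n → Colour
      κ = (λ _ → α′) [ u ↦ α ]
      κu : κ u ≡ α
      κu = ↦-same _ u α
      κu′ : κ u′ ≡ α′
      κu′ = ↦-other (λ _ → α′) u α (≢-sym u≢u′)
      κ-proper : ∀ {f g} → f ∈ F → g ∈ F → f ~ g → κ f ≢ κ g
      κ-proper (here refl) (here refl) a = contradiction refl (~⇒≢ a)
      κ-proper (here refl) (there (here refl)) a e = α≢α′ a (trans (≡-sym κu) (trans e κu′))
      κ-proper (there (here refl)) (here refl) a e =
        α≢α′ (~-sym a) (trans (≡-sym κu) (trans (≡-sym e) κu′))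
      κ-proper (there (here refl)) (there (here refl)) a = contradiction refl (~⇒≢ a)
      κ∈ : ∀ {f} → f ∈ F → κ f ∈ L f
      κ∈ (here refl) = subst (_∈ L u) (≡-sym κu) (proj₁ (proj₂ T))
      κ∈ (there (here refl)) = subst (_∈ L u′) (≡-sym κu′) (proj₁ (proj₂ T′))
      module P = Pinned G L unique bounded F κ κ-proper κ∈
      out : ∀ {w} → w ≢ u × w ≢ u′ → w ∉ F
      out (p , q) (here e) = p e
      out (p , q) (there (here e)) = q e
      slack : ∀ {w} → w ∉ F → ∃ λ t → P.PinSlack t × Reach G (_∉ F) w t
      slack w∉ = case witness of λ where
        (inj₁ v≢u′) → v , inj₁ (u , here refl , ~-sym (proj₁ T) ,
            subst (_∉ L v) (≡-sym κu) (proj₂ (proj₂ T))) ,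
          reach-map out (connected₂ u u′ (w∉ ∘ here) (w∉ ∘ there ∘ here) (≢-sym (~⇒≢ (proj₁ T))) v≢u′)
        (inj₂ v′≢u) → v′ , inj₁ (u′ , there (here refl) , ~-sym (proj₁ T′) ,
            subst (_∉ L v′) (≡-sym κu′) (proj₂ (proj₂ T′))) ,
          reach-map out (connected₂ u u′ (w∉ ∘ here) (w∉ ∘ there ∘ here) v′≢u (≢-sym (~⇒≢ (proj₁ T′))))
    ... | χ , cχ , on-F = special-joined T cφ cχ e (trans (on-F (here refl)) (↦-same _ u α)) ◅◅
        special-joined T′ cχ cψ (trans (on-F (there (here refl))) (↦-other (λ _ → α′) u α (≢-sym u≢u′))) e′

    -- Pinning `u` twice is impossible, so a third class mediates, with a colour `δ` of `L v` that
    -- `u` lacks and that therefore conflicts with neither `α` nor `β` at `u`. Its special pair is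
    -- the third neighbour `t` with `u`, or, if `t` also lacks `δ`, an edge off `u` where `δ`
    -- disappears on the way from `v` to `t`.
    joined-same-vertex : ∀ {u v w α β} → Special u v α → Special u w β → v ≢ w → Joined u α u β
    joined-same-vertex {u} {v} {w} {α} {β} T T′ v≢w
      with exchange (proj₁ (proj₂ T)) (proj₂ (proj₂ T)) | nbhd-with₂ (proj₁ T) (proj₁ T′) v≢w
    ... | δ , δ∈v , δ∉u | t , N with δ ∈?ᶜ L t
    ...   | yes δ∈t = joined-trans Tt
              (link T Tt (~⇒≢ (N3.az N)) (λ _ → ≢δ (proj₁ (proj₂ T))) (inj₁ (N3.x≢z N)))
              (joined-sym (link T′ Tt (~⇒≢ (N3.az N)) (λ _ → ≢δ (proj₁ (proj₂ T′))) (inj₁ (N3.y≢z N))))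
      where
      Tt : Special t u δ
      Tt = ~-sym (N3.az N) , δ∈t , δ∉u
      ≢δ : ∀ {γ} → γ ∈ L u → γ ≢ δ
      ≢δ γ∈ refl = δ∉u γ∈
    ...   | no δ∉t with crossing (λ x → ¬? (δ ∈?ᶜ L x))
                (connected₂ u u (≢-sym (~⇒≢ (N3.ax N))) (≢-sym (~⇒≢ (N3.ax N)))
                  (≢-sym (~⇒≢ (N3.az N))) (≢-sym (~⇒≢ (N3.az N)))) (λ ∉ → ∉ δ∈v) δ∉t
    ...     | x , x′ , (x≢u , _) , (x′≢u , _) , a , ¬¬δ∈x , δ∉x′ with δ ∈?ᶜ L x
    ...       | no δ∉x = contradiction δ∉x ¬¬δ∈x
    ...       | yes δ∈x = joined-trans Tx
                  (link T Tx (≢-sym x≢u) (λ _ → ≢δ (proj₁ (proj₂ T))) (inj₂ x′≢u))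
                  (joined-sym (link T′ Tx (≢-sym x≢u) (λ _ → ≢δ (proj₁ (proj₂ T′))) (inj₂ x′≢u)))
      where
      Tx : Special x x′ δ
      Tx = a , δ∈x , δ∉x′
      ≢δ : ∀ {γ} → γ ∈ L u → γ ≢ δ
      ≢δ γ∈ refl = δ∉u γ∈

    -- The ends of an edge cannot both be pinned to `α`, so a class with another colour `γ`
    -- mediates. If the third neighbour `t` lacks `α`, it has a colour that `u` lacks; otherwise
    -- some edge off `u` and `x` leads from a list without `α` to one with it, and `exchange`
    -- applies there.
    joined-same-colour : ∀ {u v x y α} → Special u v α → Special x y α → u ~ x → Joined u α x α
    joined-same-colour {u} {v} {x} {y} {α} T T′ u~x
      with nbhd-with₂ (proj₁ T) u~x (λ { refl → proj₂ (proj₂ T) (proj₁ (proj₂ T′)) })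
    ... | t , N with α ∈?ᶜ L t
    ...   | no α∉t with exchange (proj₁ (proj₂ T)) α∉t
    ...     | γ , γ∈t , γ∉u = joined-trans Tt
                (link T Tt (~⇒≢ (N3.az N)) (λ _ → α≢γ) (inj₁ (N3.x≢z N)))
                (joined-sym (link T′ Tt (N3.y≢z N) (λ _ → α≢γ) (inj₂ (~⇒≢ u~x))))
      where
      Tt : Special t u γ
      Tt = ~-sym (N3.az N) , γ∈t , γ∉u
      α≢γ : α ≢ γ
      α≢γ refl = α∉t γ∈t
    joined-same-colour {u} {v} {x} {y} {α} T T′ u~x | t , N | yes α∈t
      with crossing (λ x → α ∈?ᶜ L x) (connected₂ u x (≢-sym (~⇒≢ (N3.ax N))) (N3.x≢y N)
                  (≢-sym (~⇒≢ (N3.az N))) (≢-sym (N3.y≢z N))) (proj₂ (proj₂ T)) α∈t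
    ... | q , q′ , (q≢u , q≢x) , (q′≢u , q′≢x) , a , α∉q , α∈q′ with exchange α∈q′ α∉q
    ...   | γ , γ∈q , γ∉q′ = joined-trans Tq
                (link T Tq (≢-sym q≢u) (λ _ → α≢γ) (inj₂ q′≢u))
                (joined-sym (link T′ Tq (≢-sym q≢x) (λ _ → α≢γ) (inj₂ q′≢x)))
      where
      Tq : Special q q′ γ
      Tq = a , γ∈q , γ∉q′
      α≢γ : α ≢ γ
      α≢γ refl = α∉q γ∈q

    -- A swap can only fail to be L-valid if φ already is in the class of some special pair.
    invalid-edge : ∀ {φ} → Col φ → ∀ {α β u w} → Chain G φ α β u w → α ∈ L u → β ∈ L u →
      ¬ (α ∈ L w × β ∈ L w) →
      ∃ λ t → ∃ λ t′ → Special t t′ (φ t) × Bi φ α β t × Bi φ α β t′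
    invalid-edge {φ} (pr , ∈L) {α} {β} r α∈ β∈ ¬both
      with crossing (λ x → ¬? ((α ∈?ᶜ L x) ×-dec (β ∈?ᶜ L x))) r (λ ¬p → ¬p (α∈ , β∈)) ¬both
    ... | t , t′ , bt , bt′ , a , _ , ¬both′ = t , t′ , (a , ∈L t , φt∉) , bt , bt′
      where
      φt∉ : φ t ∉ L t′
      φt∉ φt∈ = case bt , bt′ of λ where
        (inj₁ e , inj₁ e′) → pr t t′ a (trans e (≡-sym e′))
        (inj₁ refl , inj₂ refl) → ¬both′ (φt∈ , ∈L t′)
        (inj₂ refl , inj₁ refl) → ¬both′ (∈L t′ , φt∈)
        (inj₂ e , inj₂ e′) → pr t t′ a (trans e (≡-sym e′))

    -- If the swap giving `u` the colour `α` is invalid, `invalid-edge` puts `φ` in the class of a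
    -- special pair at `t`. What remains is to join that class to the one at `u`: the same vertex,
    -- adjacent vertices with equal colours, or the generic `link`.
    reach-special : ∀ {u v α} → Special u v α → ∀ {φ ψ} → Col φ → Col ψ → ψ u ≡ α → φ ≋ ψ
    reach-special {u} {v} {α} T {φ} {ψ} cφ cψ ψu
      with any? (λ w → chain? G φ α (φ u) u w ×-dec ¬? ((α ∈?ᶜ L w) ×-dec (φ u ∈?ᶜ L w)))
    ... | no none = eq ◅◅ special-joined T (≋-col cφ eq) cψ
            (trans (proj₁ (S u) (here (inj₂ refl))) (sw-β α (φ u))) ψu
      where
      S : IsSwap G φ (swapAt G φ α (φ u) u) α (φ u) u
      S = swapAt-isSwap G φ α (φ u) u
      valid : ∀ w → swapAt G φ α (φ u) u w ∈ L w
      valid w with chain? G φ α (φ u) u w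
      ... | no ¬c = subst (_∈ L w) (≡-sym (proj₂ (S w) ¬c)) (proj₂ cφ w)
      ... | yes c with (α ∈?ᶜ L w) ×-dec (φ u ∈?ᶜ L w)
      ...   | no ¬both = contradiction (w , c , ¬both) none
      ...   | yes (α∈ , β∈) = case sw-mem (reach-target c) of λ where
                (inj₁ e) → subst (_∈ L w) (≡-sym (trans (proj₁ (S w) c) e)) α∈
                (inj₂ e) → subst (_∈ L w) (≡-sym (trans (proj₁ (S w) c) e)) β∈
      eq : φ ≋ swapAt G φ α (φ u) u
      eq = swap-≋ cφ valid (inj₂ refl) S
    ... | yes (w , c , ¬both) with invalid-edge cφ c (proj₁ (proj₂ T)) (proj₂ cφ u) ¬both
    ...   | t , t′ , Tt , bt , bt′ with t ≟ u
    ...     | yes refl = joined-same-vertex Tt T (λ { refl → proj₂ (proj₂ T) α∈t′ }) cφ cψ refl ψu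
      where
      α∈t′ : α ∈ L t′
      α∈t′ = case bt′ of λ where
        (inj₁ refl) → proj₂ cφ t′
        (inj₂ e) → contradiction (≡-sym e) (proj₁ cφ u t′ (proj₁ Tt))
    ...     | no t≢u with adj? G u t ×-dec (φ t ≟ᶜ α)
    ...       | yes (u~t , refl) = joined-sym (joined-same-colour T Tt u~t) cφ cψ refl ψu
    ...       | no ¬bad = joined-sym (link T Tt (≢-sym t≢u)
                  (λ a e → ¬bad (a , ≡-sym e)) (inj₁ v≢t)) cφ cψ refl ψu
      where
      v≢t : v ≢ t
      v≢t refl = case bt of λ where
        (inj₁ e) → proj₂ (proj₂ T) (subst (_∈ L v) e (proj₂ cφ v))
        (inj₂ e) → proj₁ cφ u v (proj₁ T) (≡-sym e)

    unequal-swappable : ∀ {u v α} → Special u v α → LSwappable G L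
    unequal-swappable T with special-exists T
    ... | χ , cχ , e = (χ , cχ) , λ φ ψ cφ cψ →
      reach-special T cφ cχ e ◅◅ ≋-sym (reach-special T cψ cχ e)

-- Recognising small graphs

iso-to : ∀ {n} {G : Graph n} {V : Set} {R : V → V → Set} (g : V → Fin n) →
  (∀ {i j} → g i ≡ g j → i ≡ j) → (∀ w → ∃ λ i → g i ≡ w) →
  (∀ {i j} → Adj G (g i) (g j) → R i j) → (∀ {i j} → R i j → Adj G (g i) (g j)) → IsoTo G V R
iso-to {G = G} {R = R} g inj cover sound complete =
  mk⤖ {to = proj₁ ∘ cover}
    ( (λ {x} {y} e → trans (≡-sym (proj₂ (cover x))) (trans (cong g e) (proj₂ (cover y))))
    , (λ i → g i , λ { refl → inj (proj₂ (cover (g i))) }) )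
  , λ u v → mk⇔
      (λ a → sound (subst₂ (Adj G) (≡-sym (proj₂ (cover u))) (≡-sym (proj₂ (cover v))) a))
      (λ r → subst₂ (Adj G) (proj₂ (cover u)) (proj₂ (cover v)) (complete r))

module _ {n : ℕ} {G : Graph n} (connected : ∀ u v → Reach G (λ _ → ⊤) u v) where

  -- The image of `g` is closed under adjacency, so by connectedness it is all of `G`.
  iso-by-nbrs : ∀ {V : Set} {R : V → V → Set} (g : V → Fin n) → V →
    (∀ {i j} → g i ≡ g j → i ≡ j) →
    (∀ i {w} → Adj G (g i) w → ∃ λ j → g j ≡ w × R i j) →
    (∀ {i j} → R i j → Adj G (g i) (g j)) → IsoTo G V R
  iso-by-nbrs {R = R} g i₀ inj nbrs complete = iso-to {G = G} g inj cover sound complete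
    where
    cover : ∀ w → ∃ λ i → g i ≡ w
    cover w = reach-closed {Q = λ w → ∃ λ i → g i ≡ w}
      (λ { (i , refl) a _ → let j , e , _ = nbrs i a in j , e }) (i₀ , refl) (connected (g i₀) w)
    sound : ∀ {i j} → Adj G (g i) (g j) → R i j
    sound {i} a with nbrs i a
    ... | j , e , r = subst (R i) (inj e) r

  iso-K4 : ∀ {a b c d} → N3 G a b c d → N3 G b a c d → N3 G c a b d → N3 G d a b c →
    IsoTo G (Fin 4) K4Adj
  iso-K4 {a} {b} {c} {d} A B C D = iso-by-nbrs g 0F inj nbrs complete
    where
    g : Fin 4 → Fin n
    g = Vec.lookup (a Vec.∷ b Vec.∷ c Vec.∷ d Vec.∷ Vec.[])
    complete : ∀ {i j} → i ≢ j → Adj G (g i) (g j)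
    complete {0F} {0F} ne = contradiction refl ne
    complete {0F} {1F} _ = N3.ax A
    complete {0F} {2F} _ = N3.ay A
    complete {0F} {3F} _ = N3.az A
    complete {1F} {0F} _ = N3.ax B
    complete {1F} {1F} ne = contradiction refl ne
    complete {1F} {2F} _ = N3.ay B
    complete {1F} {3F} _ = N3.az B
    complete {2F} {0F} _ = N3.ax C
    complete {2F} {1F} _ = N3.ay C
    complete {2F} {2F} ne = contradiction refl ne
    complete {2F} {3F} _ = N3.az C
    complete {3F} {0F} _ = N3.ax D
    complete {3F} {1F} _ = N3.ay D
    complete {3F} {2F} _ = N3.az D
    complete {3F} {3F} ne = contradiction refl ne
    inj : ∀ {i j} → g i ≡ g j → i ≡ j
    inj {i} {j} e with i ≟ j
    ... | yes p = p
    ... | no ne = contradiction e (adj⇒≢ G (complete ne))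
    nbrs : ∀ i {w} → Adj G (g i) w → ∃ λ j → g j ≡ w × i ≢ j
    nbrs 0F a with N3.all A a
    ... | inj₁ refl = 1F , refl , λ ()
    ... | inj₂ (inj₁ refl) = 2F , refl , λ ()
    ... | inj₂ (inj₂ refl) = 3F , refl , λ ()
    nbrs 1F a with N3.all B a
    ... | inj₁ refl = 0F , refl , λ ()
    ... | inj₂ (inj₁ refl) = 2F , refl , λ ()
    ... | inj₂ (inj₂ refl) = 3F , refl , λ ()
    nbrs 2F a with N3.all C a
    ... | inj₁ refl = 0F , refl , λ ()
    ... | inj₂ (inj₁ refl) = 1F , refl , λ ()
    ... | inj₂ (inj₂ refl) = 3F , refl , λ ()
    nbrs 3F a with N3.all D a
    ... | inj₁ refl = 0F , refl , λ ()
    ... | inj₂ (inj₁ refl) = 1F , refl , λ ()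
    ... | inj₂ (inj₂ refl) = 2F , refl , λ ()

  iso-prism : ∀ {a b c a′ b′ c′} → N3 G a b c a′ → N3 G b a c b′ → N3 G c a b c′ →
    N3 G a′ b′ c′ a → N3 G b′ a′ c′ b → N3 G c′ a′ b′ c → IsoTo G (Fin 2 × Fin 3) PrismAdj
  iso-prism {a} {b} {c} {a′} {b′} {c′} A B C A′ B′ C′ =
    iso-by-nbrs g (zero , zero) (inj _ _) nbrs complete
    where
    g : Fin 2 × Fin 3 → Fin n
    g (0F , 0F) = a
    g (0F , 1F) = b
    g (0F , 2F) = c
    g (1F , 0F) = a′
    g (1F , 1F) = b′
    g (1F , 2F) = c′
    row : ∀ i {j k} → j ≢ k → Adj G (g (i , j)) (g (i , k))
    row i {0F} {0F} ne = contradiction refl ne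
    row i {1F} {1F} ne = contradiction refl ne
    row i {2F} {2F} ne = contradiction refl ne
    row 0F {0F} {1F} _ = N3.ax A
    row 0F {0F} {2F} _ = N3.ay A
    row 0F {1F} {0F} _ = N3.ax B
    row 0F {1F} {2F} _ = N3.ay B
    row 0F {2F} {0F} _ = N3.ax C
    row 0F {2F} {1F} _ = N3.ay C
    row 1F {0F} {1F} _ = N3.ax A′
    row 1F {0F} {2F} _ = N3.ay A′
    row 1F {1F} {0F} _ = N3.ax B′
    row 1F {1F} {2F} _ = N3.ay B′
    row 1F {2F} {0F} _ = N3.ax C′
    row 1F {2F} {1F} _ = N3.ay C′
    column : ∀ {i k} j → i ≢ k → Adj G (g (i , j)) (g (k , j))
    column {0F} {0F} j ne = contradiction refl ne
    column {1F} {1F} j ne = contradiction refl ne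
    column {0F} {1F} 0F _ = N3.az A
    column {0F} {1F} 1F _ = N3.az B
    column {0F} {1F} 2F _ = N3.az C
    column {1F} {0F} 0F _ = N3.az A′
    column {1F} {0F} 1F _ = N3.az B′
    column {1F} {0F} 2F _ = N3.az C′
    complete : ∀ {i j} → PrismAdj i j → Adj G (g i) (g j)
    complete {i , _} (inj₁ (refl , ne)) = row i ne
    complete {_ , j} (inj₂ (ne , refl)) = column j ne
    cross : ∀ j k → g (0F , j) ≢ g (1F , k)
    cross 0F 0F = adj⇒≢ G (N3.az A)
    cross 0F 1F = N3.x≢z B
    cross 0F 2F = N3.x≢z C
    cross 1F 0F = N3.x≢z A
    cross 1F 1F = adj⇒≢ G (N3.az B)
    cross 1F 2F = N3.y≢z C
    cross 2F 0F = N3.y≢z A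
    cross 2F 1F = N3.y≢z B
    cross 2F 2F = adj⇒≢ G (N3.az C)
    inj : ∀ i j → g i ≡ g j → i ≡ j
    inj (0F , j) (0F , k) e with j ≟ k
    ... | yes refl = refl
    ... | no ne = contradiction e (adj⇒≢ G (row 0F ne))
    inj (1F , j) (1F , k) e with j ≟ k
    ... | yes refl = refl
    ... | no ne = contradiction e (adj⇒≢ G (row 1F ne))
    inj (0F , j) (1F , k) e = contradiction e (cross j k)
    inj (1F , j) (0F , k) e = contradiction (≡-sym e) (cross k j)
    nbrs : ∀ i {w} → Adj G (g i) w → ∃ λ j → g j ≡ w × PrismAdj i j
    nbrs (0F , 0F) e with N3.all A e
    ... | inj₁ refl = (0F , 1F) , refl , inj₁ (refl , λ ())
    ... | inj₂ (inj₁ refl) = (0F , 2F) , refl , inj₁ (refl , λ ())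
    ... | inj₂ (inj₂ refl) = (1F , 0F) , refl , inj₂ ((λ ()) , refl)
    nbrs (0F , 1F) e with N3.all B e
    ... | inj₁ refl = (0F , 0F) , refl , inj₁ (refl , λ ())
    ... | inj₂ (inj₁ refl) = (0F , 2F) , refl , inj₁ (refl , λ ())
    ... | inj₂ (inj₂ refl) = (1F , 1F) , refl , inj₂ ((λ ()) , refl)
    nbrs (0F , 2F) e with N3.all C e
    ... | inj₁ refl = (0F , 0F) , refl , inj₁ (refl , λ ())
    ... | inj₂ (inj₁ refl) = (0F , 1F) , refl , inj₁ (refl , λ ())
    ... | inj₂ (inj₂ refl) = (1F , 2F) , refl , inj₂ ((λ ()) , refl)
    nbrs (1F , 0F) e with N3.all A′ e
    ... | inj₁ refl = (1F , 1F) , refl , inj₁ (refl , λ ())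
    ... | inj₂ (inj₁ refl) = (1F , 2F) , refl , inj₁ (refl , λ ())
    ... | inj₂ (inj₂ refl) = (0F , 0F) , refl , inj₂ ((λ ()) , refl)
    nbrs (1F , 1F) e with N3.all B′ e
    ... | inj₁ refl = (1F , 0F) , refl , inj₁ (refl , λ ())
    ... | inj₂ (inj₁ refl) = (1F , 2F) , refl , inj₁ (refl , λ ())
    ... | inj₂ (inj₂ refl) = (0F , 1F) , refl , inj₂ ((λ ()) , refl)
    nbrs (1F , 2F) e with N3.all C′ e
    ... | inj₁ refl = (1F , 0F) , refl , inj₁ (refl , λ ())
    ... | inj₂ (inj₁ refl) = (1F , 1F) , refl , inj₁ (refl , λ ())
    ... | inj₂ (inj₂ refl) = (0F , 2F) , refl , inj₂ ((λ ()) , refl)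

-- Equal lists

module Equal {n : ℕ} (G : Graph n) (L : ListAssignment n)
  (reg : Regular G 3) (conn : KConnected G 3) (assign : IsKAssignment 3 L)
  (same : ∀ {v w c} → c ∈ L v → c ∈ L w) where

  open Cubic G L reg conn assign

  no-four-colours : ∀ {v p q r s} → p ∈ L v → q ∈ L v → r ∈ L v → s ∈ L v →
    Unique (p ∷ q ∷ r ∷ s ∷ []) → ⊥
  no-four-colours {v} p∈ q∈ r∈ s∈ u = contradiction
    (≤-trans (⊆⇒length≤ u λ where
      (here refl) → p∈
      (there (here refl)) → q∈
      (there (there (here refl))) → r∈
      (there (there (there (here refl)))) → s∈) (≤-reflexive (proj₂ (assign v)))) 1+n≰n

  last-two : ∀ {φ} → Col φ → ∀ {a b c d} → φ a ≢ φ b → φ a ≢ φ c → φ b ≢ φ c → φ d ≢ φ a →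
    φ d ≡ φ b ⊎ φ d ≡ φ c
  last-two {φ} (_ , ∈L) {a} {b} {c} {d} ab ac bc da with φ d ≟ᶜ φ b | φ d ≟ᶜ φ c
  ... | yes e | _ = inj₁ e
  ... | no _ | yes e = inj₂ e
  ... | no db | no dc = ⊥-elim (no-four-colours (∈L a) (same (∈L b)) (same (∈L c)) (same (∈L d))
          ((ab ∷ ac ∷ ≢-sym da ∷ []) ∷ (bc ∷ ≢-sym db ∷ []) ∷ (≢-sym dc ∷ []) ∷ [] ∷ []))

  two-equal : ∀ {φ} → Col φ → ∀ {v x y z} → N3 G v x y z → φ x ≡ φ y ⊎ φ x ≡ φ z ⊎ φ y ≡ φ z
  two-equal {φ} cφ {v} {x} {y} {z} N with φ x ≟ᶜ φ y
  ... | yes e = inj₁ e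
  ... | no xy with last-two cφ {v} {x} {y} {z} (pr v x (N3.ax N)) (pr v y (N3.ay N)) xy
                    (pr z v (~-sym (N3.az N)))
    where pr = proj₁ cφ
  ...   | inj₁ e = inj₂ (inj₁ (≡-sym e))
  ...   | inj₂ e = inj₂ (inj₂ (≡-sym e))

  free-swap : ∀ {φ α β u v} → Col φ → α ∈ L v → β ∈ L v → Bi φ α β u → φ ≋ swapAt G φ α β u
  free-swap {φ} {α} {β} {u} cφ α∈ β∈ b = swap-≋ cφ valid b S
    where
    S : IsSwap G φ (swapAt G φ α β u) α β u
    S = swapAt-isSwap G φ α β u
    valid : ∀ w → swapAt G φ α β u w ∈ L w
    valid w with chain? G φ α β u w
    ... | no ¬c = subst (_∈ L w) (≡-sym (proj₂ (S w) ¬c)) (proj₂ cφ w)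
    ... | yes c with sw-mem (reach-target c)
    ...   | inj₁ e = subst (_∈ L w) (≡-sym (trans (proj₁ (S w) c) e)) (same α∈)
    ...   | inj₂ e = subst (_∈ L w) (≡-sym (trans (proj₁ (S w) c) e)) (same β∈)

  -- The vertices `x` and `y` lie in one chain or in two; one or two swaps recolour both. Hence a
  -- class need not record the common colour of its pair.
  change-colour : ∀ {φ x y c} → Col φ → φ x ≡ φ y → c ∈ L x →
    ∃ λ φ′ → φ ≋ φ′ × φ′ x ≡ c × φ′ y ≡ c
  change-colour {φ} {x} {y} {c} cφ e c∈ with chain? G φ (φ x) c x y
  ... | yes ch = φ₁ , free-swap cφ (proj₂ cφ x) c∈ (inj₁ refl) ,
          trans (proj₁ (S₁ x) (here (inj₁ refl))) (sw-α (φ x) c) ,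
          trans (proj₁ (S₁ y) ch) (trans (cong (sw (φ x) c) (≡-sym e)) (sw-α (φ x) c))
    where
    φ₁ : Fin n → Colour
    φ₁ = swapAt G φ (φ x) c x
    S₁ : IsSwap G φ φ₁ (φ x) c x
    S₁ = swapAt-isSwap G φ (φ x) c x
  ... | no ¬ch = φ₂ , eq₁ ◅◅ eq₂ ,
          trans (proj₂ (S₂ x) (λ ch → ¬ch (reach-map (swap-bi⁻ S₁) (reach-sym ch))))
            (trans (proj₁ (S₁ x) (here (inj₁ refl))) (sw-α (φ x) c)) ,
          trans (proj₁ (S₂ y) (here (inj₁ φ₁y))) (trans (cong (sw (φ x) c) φ₁y) (sw-α (φ x) c))
    where
    φ₁ φ₂ : Fin n → Colour
    φ₁ = swapAt G φ (φ x) c x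
    φ₂ = swapAt G φ₁ (φ x) c y
    S₁ : IsSwap G φ φ₁ (φ x) c x
    S₁ = swapAt-isSwap G φ (φ x) c x
    S₂ : IsSwap G φ₁ φ₂ (φ x) c y
    S₂ = swapAt-isSwap G φ₁ (φ x) c y
    φ₁y : φ₁ y ≡ φ x
    φ₁y = trans (proj₂ (S₁ y) ¬ch) (≡-sym e)
    eq₁ : φ ≋ φ₁
    eq₁ = free-swap cφ (proj₂ cφ x) c∈ (inj₁ refl)
    eq₂ : φ₁ ≋ φ₂
    eq₂ = free-swap (≋-col cφ eq₁) (proj₂ cφ x) c∈ (inj₁ φ₁y)

  some-colour : ∀ v → ∃ (_∈ L v)
  some-colour v with L v | proj₂ (assign v)
  ... | c ∷ _ | _ = c , here refl

  module _ (F : List (Fin n)) (independent : ∀ {f g} → f ∈ F → g ∈ F → f ≁ g)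
    (slack : ∀ {w} → w ∉ F → ∃ λ t →
      (∃ λ f → ∃ λ g → f ∈ F × g ∈ F × f ≢ g × t ~ f × t ~ g) × Reach G (_∉ F) w t)
    (u : Fin n) where

    private
      module P {c} (c∈ : c ∈ L u) = Pinned G L unique bounded F (λ _ → c)
        (λ f∈ g∈ a → contradiction a (independent f∈ g∈)) (λ _ → same c∈)
      slack′ : ∀ {c} (c∈ : c ∈ L u) {w} → w ∉ F → ∃ λ t → P.PinSlack c∈ t × Reach G (_∉ F) w t
      slack′ c∈ w∉ with slack w∉
      ... | t , (f , g , f∈ , g∈ , f≢g , af , ag) , r =
        t , inj₂ (f , g , f∈ , g∈ , f≢g , af , ag , refl) , r

    mono-exists : ∃ λ φ → ∃ λ c → Col φ × (∀ {f} → f ∈ F → φ f ≡ c)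
    mono-exists with some-colour u
    ... | c , c∈ with P.pinned-exists c∈ (slack′ c∈)
    ...   | φ , cφ , e = φ , c , cφ , e

    mono-≋ : ∀ {c φ ψ} → c ∈ L u → Col φ → Col ψ → (∀ {f} → f ∈ F → φ f ≡ c) →
      (∀ {f} → f ∈ F → ψ f ≡ c) → φ ≋ ψ
    mono-≋ c∈ cφ cψ e e′ = P.pinned-≋ c∈ (slack′ c∈) u cφ cψ e e′

  -- Classes of colourings with two equally coloured vertices

  record Good (x y : Fin n) : Set where
    constructor good
    field
      {centre} : Fin n
      x≢y : x ≢ y
      x≁y : x ≁ y
      v~x : centre ~ x
      v~y : centre ~ y

  good-sym : ∀ {x y} → Good x y → Good y x
  good-sym (good x≢y x≁y a b) = good (≢-sym x≢y) (x≁y ∘ ~-sym) b a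

  module _ {x y} (gd : Good x y) where
    private
      open Good gd
      F : List (Fin n)
      F = x ∷ y ∷ []
      independent : ∀ {f g} → f ∈ F → g ∈ F → f ≁ g
      independent (here refl) (here refl) a = ~⇒≢ a refl
      independent (here refl) (there (here refl)) a = x≁y a
      independent (there (here refl)) (here refl) a = x≁y (~-sym a)
      independent (there (here refl)) (there (here refl)) a = ~⇒≢ a refl
      slack : ∀ {w} → w ∉ F → ∃ λ t →
        (∃ λ f → ∃ λ g → f ∈ F × g ∈ F × f ≢ g × t ~ f × t ~ g) × Reach G (_∉ F) w t
      slack w∉ = centre , (x , y , here refl , there (here refl) , x≢y , v~x , v~y) ,
        reach-map (λ where
            (p , q) (here e) → p e
            (p , q) (there (here e)) → q e)
          (connected₂ x y (w∉ ∘ here) (w∉ ∘ there ∘ here) (~⇒≢ v~x) (~⇒≢ v~y))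

    good-exists : ∃ λ φ → Col φ × φ x ≡ φ y
    good-exists with mono-exists F independent slack x
    ... | φ , c , cφ , e = φ , cφ , trans (e (here refl)) (≡-sym (e (there (here refl))))

    -- Once the common colours match, `centre` sees that colour twice, and deleting `x` and `y`
    -- leaves the graph connected.
    good-≋ : ∀ {φ ψ} → Col φ → Col ψ → φ x ≡ φ y → ψ x ≡ ψ y → φ ≋ ψ
    good-≋ {φ} {ψ} cφ cψ e e′ with change-colour cφ e (proj₂ cψ x)
    ... | φ₁ , eq , φ₁x , φ₁y = eq ◅◅ mono-≋ F independent slack x (proj₂ cψ x) (≋-col cφ eq) cψ
      (λ where
        (here refl) → φ₁x
        (there (here refl)) → φ₁y)
      (λ where
        (here refl) → refl
        (there (here refl)) → ≡-sym e′)

  Joined : (a b c d : Fin n) → Set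
  Joined a b c d = ∀ {φ ψ} → Col φ → Col ψ → φ a ≡ φ b → ψ c ≡ ψ d → φ ≋ ψ

  joined-sym : ∀ {a b c d} → Joined a b c d → Joined c d a b
  joined-sym J cφ cψ e e′ = ≋-sym (J cψ cφ e′ e)

  joined-trans : ∀ {a b c d e f} → Good c d → Joined a b c d → Joined c d e f → Joined a b e f
  joined-trans gd J J′ cφ cψ p q with good-exists gd
  ... | χ , cχ , r = J cφ cχ p r ◅◅ J′ cχ cψ r q

  AllEquivalent : Set
  AllEquivalent = ∀ {φ ψ} → Col φ → Col ψ → φ ≋ ψ

  by-good : ∀ {x y} → Good x y → (∀ {φ} → Col φ → ∃ λ φ′ → φ ≋ φ′ × φ′ x ≡ φ′ y) → AllEquivalent
  by-good gd reach cφ cψ with reach cφ | reach cψ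
  ... | φ′ , p , e | ψ′ , q , e′ = p ◅◅ good-≋ gd (≋-col cφ p) (≋-col cψ q) e e′ ◅◅ ≋-sym q

  Out : (a b c w : Fin n) → Set
  Out a b c w = w ≢ a × w ≢ b × w ≢ c

  TwoOf : (a b c t : Fin n) → Set
  TwoOf a b c t = (t ~ a × t ~ b) ⊎ (t ~ a × t ~ c) ⊎ (t ~ b × t ~ c)

  Mono : (a b c : Fin n) → Set
  Mono a b c = ∃ λ χ → Col χ × χ a ≡ χ b × χ a ≡ χ c

  record Independent (a b c : Fin n) : Set where
    constructor independent
    field
      a≢b : a ≢ b
      a≢c : a ≢ c
      b≢c : b ≢ c
      a≁b : a ≁ b
      a≁c : a ≁ c
      b≁c : b ≁ c

  -- Deleting three vertices may disconnect the graph, so the existence of a vertex with two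
  -- neighbours in the triple has to be supplied for every component.
  mono-triple : ∀ {a b c} → Independent a b c →
    (∀ {w} → Out a b c w → ∃ λ t → TwoOf a b c t × Reach G (Out a b c) w t) → Mono a b c
  mono-triple {a} {b} {c} I slack with mono-exists F indep slack′ a
    where
    open Independent I
    F : List (Fin n)
    F = a ∷ b ∷ c ∷ []
    indep : ∀ {f g} → f ∈ F → g ∈ F → f ≁ g
    indep (here refl) (here refl) e = ~⇒≢ e refl
    indep (here refl) (there (here refl)) = a≁b
    indep (here refl) (there (there (here refl))) = a≁c
    indep (there (here refl)) (here refl) = a≁b ∘ ~-sym
    indep (there (here refl)) (there (here refl)) e = ~⇒≢ e refl
    indep (there (here refl)) (there (there (here refl))) = b≁c
    indep (there (there (here refl))) (here refl) = a≁c ∘ ~-sym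
    indep (there (there (here refl))) (there (here refl)) = b≁c ∘ ~-sym
    indep (there (there (here refl))) (there (there (here refl))) e = ~⇒≢ e refl
    slack′ : ∀ {w} → w ∉ F → ∃ λ t →
      (∃ λ f → ∃ λ g → f ∈ F × g ∈ F × f ≢ g × t ~ f × t ~ g) × Reach G (_∉ F) w t
    slack′ w∉ with slack (w∉ ∘ here , w∉ ∘ there ∘ here , w∉ ∘ there ∘ there ∘ here)
    ... | t , two , r = t , pick two , reach-map out r
      where
      out : ∀ {x} → Out a b c x → x ∉ F
      out (p , q , r) (here e) = p e
      out (p , q , r) (there (here e)) = q e
      out (p , q , r) (there (there (here e))) = r e
      pick : TwoOf a b c t → ∃ λ f → ∃ λ g → f ∈ F × g ∈ F × f ≢ g × t ~ f × t ~ g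
      pick (inj₁ (p , q)) = a , b , here refl , there (here refl) , a≢b , p , q
      pick (inj₂ (inj₁ (p , q))) = a , c , here refl , there (there (here refl)) , a≢c , p , q
      pick (inj₂ (inj₂ (p , q))) = b , c , there (here refl) , there (there (here refl)) , b≢c , p , q
  ... | χ , k , cχ , e = χ , cχ , trans (e (here refl)) (≡-sym (e (there (here refl)))) ,
          trans (e (here refl)) (≡-sym (e (there (there (here refl)))))

  mono-joined : ∀ {a b c} → Good a b → Good a c → Mono a b c → Joined a b a c
  mono-joined gb gc (χ , cχ , e , e′) cφ cψ p q = good-≋ gb cφ cχ p e ◅◅ good-≋ gc cχ cψ e′ q

  -- Three different colours around `v` would leave none for `v`, so the three classes cover all
  -- colourings.
  claw : ∀ {v x y z} → N3 G v x y z → Good x y →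
    Joined x z x y → Joined y z x y → AllEquivalent
  claw N gd J J′ = by-good gd λ cφ → let χ , cχ , e = good-exists gd in case two-equal cφ N of λ where
    (inj₁ p) → _ , ε , p
    (inj₂ (inj₁ p)) → χ , J cφ cχ p e , e
    (inj₂ (inj₂ p)) → χ , J′ cφ cχ p e , e

  mono-claw : ∀ {v x y z} → N3 G v x y z → Independent x y z → Mono x y z → AllEquivalent
  mono-claw N I M@(χ , cχ , e , e′) = claw N gxy
      (joined-sym (mono-joined gxy gxz M))
      (λ cφ cψ p q → good-≋ gyz cφ cχ p (trans (≡-sym e) e′) ◅◅ good-≋ gxy cχ cψ e q)
    where
    open Independent I
    gxy = good a≢b a≁b (N3.ax N) (N3.ay N)
    gxz = good a≢c a≁c (N3.ax N) (N3.az N)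
    gyz = good b≢c b≁c (N3.ay N) (N3.az N)

  -- Triangles

  diamond : ¬ IsoTo G (Fin 4) K4Adj → ∀ {a b c d} → N3 G a b c d → N3 G b a c d → AllEquivalent
  diamond not-K4 {a} {b} {c} {d} A B with adj? G c d
  ... | yes c~d = contradiction (iso-K4 connected A B
            (nbhd-with₃ (~-sym (N3.ay A)) (~-sym (N3.ay B)) c~d (~⇒≢ (N3.ax A)) (~⇒≢ (N3.az A)) (~⇒≢ (N3.az B)))
            (nbhd-with₃ (~-sym (N3.az A)) (~-sym (N3.az B)) (~-sym c~d) (~⇒≢ (N3.ax A)) (~⇒≢ (N3.ay A)) (~⇒≢ (N3.ay B))))
          not-K4
  ... | no c≁d = by-good (good (N3.y≢z A) c≁d (N3.ay A) (N3.az A)) λ cφ@(pr , _) → _ , ε ,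
          (case last-two cφ {a} {b} {c} {d} (pr _ _ (N3.ax A)) (pr _ _ (N3.ay A)) (pr _ _ (N3.ay B))
              (pr _ _ (~-sym (N3.az A))) of λ where
            (inj₁ e) → contradiction e (pr _ _ (~-sym (N3.az B)))
            (inj₂ e) → ≡-sym e)

  record Tri (a b c a′ b′ c′ : Fin n) : Set where
    field
      A : N3 G a b c a′
      B : N3 G b a c b′
      C : N3 G c a b c′
      a′≢b′ : a′ ≢ b′
      a′≢c′ : a′ ≢ c′
      b′≢c′ : b′ ≢ c′

  tri-flip : ∀ {a b c a′ b′ c′} → Tri a b c a′ b′ c′ → Tri a c b a′ c′ b′
  tri-flip T = record { A = N3-swap₁₂ A ; B = C ; C = B
                      ; a′≢b′ = a′≢c′ ; a′≢c′ = a′≢b′ ; b′≢c′ = ≢-sym b′≢c′ }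
    where open Tri T

  tri-swap : ∀ {a b c a′ b′ c′} → Tri a b c a′ b′ c′ → Tri b a c b′ a′ c′
  tri-swap T = record { A = B ; B = A ; C = N3-swap₁₂ C
                      ; a′≢b′ = ≢-sym a′≢b′ ; a′≢c′ = b′≢c′ ; b′≢c′ = a′≢c′ }
    where open Tri T

  tri-good : ∀ {a b c a′ b′ c′} → Tri a b c a′ b′ c′ → Good a b′
  tri-good T = good (N3.x≢z B) (λ e → case N3.all A e of λ where
        (inj₁ p) → ~⇒≢ (N3.az B) (≡-sym p)
        (inj₂ (inj₁ p)) → N3.y≢z B (≡-sym p)
        (inj₂ (inj₂ p)) → a′≢b′ (≡-sym p))
      (N3.ax B) (N3.az B)
    where open Tri T

  transpose : (Fin n → Colour) → Fin n → Fin n → Fin n → Colour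
  transpose φ p q = (φ [ p ↦ φ q ]) [ q ↦ φ p ]

  module _ (φ : Fin n → Colour) {p q : Fin n} (p≢q : p ≢ q) where
    transpose-p : transpose φ p q p ≡ φ q
    transpose-p = trans (↦-other (φ [ p ↦ φ q ]) q (φ p) p≢q) (↦-same φ p (φ q))
    transpose-q : transpose φ p q q ≡ φ p
    transpose-q = ↦-same (φ [ p ↦ φ q ]) q (φ p)
    transpose-other : ∀ {w} → w ≢ p → w ≢ q → transpose φ p q w ≡ φ w
    transpose-other w≢p w≢q = trans (↦-other (φ [ p ↦ φ q ]) q (φ p) w≢q) (↦-other φ p (φ q) w≢p)

    transpose-col : Col φ → (∀ {w} → p ~ w → w ≢ q → φ q ≢ φ w) → (∀ {w} → q ~ w → w ≢ p → φ p ≢ φ w) →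
      Col (transpose φ p q)
    transpose-col (pr , ∈L) okp okq = proper , mem
      where
      at : ∀ w → (w ≡ p × transpose φ p q w ≡ φ q) ⊎ (w ≡ q × transpose φ p q w ≡ φ p) ⊎
                 (w ≢ p × w ≢ q × transpose φ p q w ≡ φ w)
      at w = case (w ≟ p) , (w ≟ q) of λ where
        (yes refl , _) → inj₁ (refl , transpose-p)
        (no _ , yes refl) → inj₂ (inj₁ (refl , transpose-q))
        (no w≢p , no w≢q) → inj₂ (inj₂ (w≢p , w≢q , transpose-other w≢p w≢q))
      mem : ∀ w → transpose φ p q w ∈ L w
      mem w with at w
      ... | inj₁ (_ , e) = subst (_∈ L w) (≡-sym e) (same (∈L q))
      ... | inj₂ (inj₁ (_ , e)) = subst (_∈ L w) (≡-sym e) (same (∈L p))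
      ... | inj₂ (inj₂ (_ , _ , e)) = subst (_∈ L w) (≡-sym e) (∈L w)
      proper : Proper G (transpose φ p q)
      proper x y a e with at x | at y
      ... | inj₁ (refl , _) | inj₁ (refl , _) = ~⇒≢ a refl
      ... | inj₁ (refl , ex) | inj₂ (inj₁ (refl , ey)) =
              pr x y a (≡-sym (trans (≡-sym ex) (trans e ey)))
      ... | inj₁ (refl , ex) | inj₂ (inj₂ (_ , y≢q , ey)) = okp a y≢q (trans (≡-sym ex) (trans e ey))
      ... | inj₂ (inj₁ (refl , ex)) | inj₁ (refl , ey) =
              pr x y a (≡-sym (trans (≡-sym ex) (trans e ey)))
      ... | inj₂ (inj₁ (refl , _)) | inj₂ (inj₁ (refl , _)) = ~⇒≢ a refl
      ... | inj₂ (inj₁ (refl , ex)) | inj₂ (inj₂ (y≢p , _ , ey)) = okq a y≢p (trans (≡-sym ex) (trans e ey))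
      ... | inj₂ (inj₂ (_ , x≢q , ex)) | inj₁ (refl , ey) =
              okp (~-sym a) x≢q (≡-sym (trans (≡-sym ex) (trans e ey)))
      ... | inj₂ (inj₂ (x≢p , _ , ex)) | inj₂ (inj₁ (refl , ey)) =
              okq (~-sym a) x≢p (≡-sym (trans (≡-sym ex) (trans e ey)))
      ... | inj₂ (inj₂ (_ , _ , ex)) | inj₂ (inj₂ (_ , _ , ey)) = pr x y a (trans (≡-sym ex) (trans e ey))

  -- Outside the edge from `a` to `c`, all neighbours of its ends have the colour of `b`, so the
  -- colours of `a` and `c` can be exchanged. Both colourings give `b` and `c′` one colour and thus
  -- lie in a single class.
  tri-exchange : ∀ {a b c a′ b′ c′} → Tri a b c a′ b′ c′ → ∀ {φ} → Col φ →
    φ b′ ≡ φ c → φ c′ ≡ φ b → φ a′ ≡ φ b → ∃ λ φ′ → φ ≋ φ′ × φ′ a ≡ φ′ b′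
  tri-exchange {a} {b} {c} {a′} {b′} {c′} T {φ} cφ@(pr , _) eb ec ea =
      φ′ , good-≋ gd cφ col (≡-sym ec) same-b ,
      trans (transpose-p φ a≢c) (trans (≡-sym eb) (≡-sym (transpose-other φ a≢c b′≢a (≢-sym (N3.y≢z B)))))
    where
    open Tri T
    a≢c : a ≢ c
    a≢c = N3.x≢y B
    b′≢a : b′ ≢ a
    b′≢a = ≢-sym (N3.x≢z B)
    φ′ : Fin n → Colour
    φ′ = transpose φ a c
    gd : Good b c′
    gd = tri-good (tri-flip (tri-swap T))
    col : Col φ′
    col = transpose-col φ a≢c cφ
      (λ e w≢c p → case N3.all A e of λ where
        (inj₁ refl) → pr _ _ (~-sym (N3.ay B)) p
        (inj₂ (inj₁ refl)) → w≢c refl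
        (inj₂ (inj₂ refl)) → pr _ _ (~-sym (N3.ay B)) (trans p ea))
      (λ e w≢a p → case N3.all C e of λ where
        (inj₁ refl) → w≢a refl
        (inj₂ (inj₁ refl)) → pr _ _ (N3.ax A) p
        (inj₂ (inj₂ refl)) → pr _ _ (N3.ax A) (trans p ec))
    same-b : φ′ b ≡ φ′ c′
    same-b = trans (transpose-other φ a≢c (~⇒≢ (N3.ax B)) (~⇒≢ (N3.ay B)))
      (trans (≡-sym ec) (≡-sym (transpose-other φ a≢c (≢-sym (N3.x≢z C)) (≢-sym (~⇒≢ (N3.az C))))))

  -- The triangle uses all three colours. If neither `b′` nor `c′` has the colour of `a`, both
  -- colours are forced, and `tri-exchange` applies to `b` or `c` according to the colour of `a′`.
  tri-joined : ∀ {a b c a′ b′ c′} → Tri a b c a′ b′ c′ → Joined a c′ a b′ → AllEquivalent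
  tri-joined {a} {b} {c} {a′} {b′} {c′} T J = by-good gd λ {φ} cφ@(pr , _) →
      case last-two cφ {b} {a} {c} {b′} (pr _ _ (N3.ax B)) (pr _ _ (N3.ay B)) (pr _ _ (N3.ay A))
             (pr _ _ (~-sym (N3.az B))) ,
           last-two cφ {c} {a} {b} {c′} (pr _ _ (N3.ax C)) (pr _ _ (N3.ay C)) (pr _ _ (N3.ax A))
             (pr _ _ (~-sym (N3.az C))) ,
           last-two cφ {a} {b} {c} {a′} (pr _ _ (N3.ax A)) (pr _ _ (N3.ay A)) (pr _ _ (N3.ay B))
             (pr _ _ (~-sym (N3.az A))) of λ where
        (inj₁ e , _) → φ , ε , ≡-sym e
        (_ , inj₁ e , _) → via cφ (≡-sym e)
        (inj₂ eb , inj₂ ec , inj₁ ea) → tri-exchange T cφ eb ec ea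
        (inj₂ eb , inj₂ ec , inj₂ ea) →
          let φ′ , p , e = tri-exchange (tri-flip T) cφ ec eb ea
              φ″ , q , e″ = via (≋-col cφ p) e in φ″ , p ◅◅ q , e″
    where
    open Tri T
    gd : Good a b′
    gd = tri-good T
    via : ∀ {φ} → Col φ → φ a ≡ φ c′ → ∃ λ φ′ → φ ≋ φ′ × φ′ a ≡ φ′ b′
    via cφ e with good-exists gd
    ... | χ , cχ , e′ = χ , J cφ cχ e e′ , e′

  module _ {a b c a′ b′ c′} (T : Tri a b c a′ b′ c′) where
    private
      open Tri T
      b≢c′ : b ≢ c′
      b≢c′ = N3.y≢z C

    -- Off `a`, `b′`, `c′` every vertex reaches `b`, `c` or `a′`. The first two see two members of
    -- the triple. They form a component of their own, so `w`, lying outside it, is joined to `a′`.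
    tri-mono : b′ ≁ c′ → ∀ {w} → w ≢ b → w ≢ c → Out a b′ c′ w → TwoOf a b′ c′ w → AllEquivalent
    tri-mono b′≁c′ {w} w≢b w≢c out two = tri-joined T
        (joined-sym (mono-joined gb gc (mono-triple indep slack)))
      where
      gb : Good a b′
      gb = tri-good T
      gc : Good a c′
      gc = tri-good (tri-flip T)
      indep : Independent a b′ c′
      indep = independent (Good.x≢y gb) (Good.x≢y gc) b′≢c′ (Good.x≁y gb) (Good.x≁y gc) b′≁c′
      R : Fin n → Fin n → Set
      R = Reach G (Out a b′ c′)
      near : ∀ {t} → Out a b′ c′ t → R t b ⊎ R t c ⊎ R t a′
      near (t≢a , t≢b′ , t≢c′)
        with first-hit (_≟ a) (connected₂ b′ c′ t≢b′ t≢c′ (~⇒≢ (N3.az B)) b≢c′) t≢a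
      ... | inj₁ r = inj₁ (reach-map (λ ((p , q) , s) → s , p , q) r)
      ... | inj₂ (m , _ , r , m~a , _ , refl) with N3.all A (~-sym m~a)
      ...   | inj₁ refl = inj₁ (reach-map (λ ((p , q) , s) → s , p , q) r)
      ...   | inj₂ (inj₁ refl) = inj₂ (inj₁ (reach-map (λ ((p , q) , s) → s , p , q) r))
      ...   | inj₂ (inj₂ refl) = inj₂ (inj₂ (reach-map (λ ((p , q) , s) → s , p , q) r))
      stay : ∀ {x y} → x ≡ b ⊎ x ≡ c → x ~ y → Out a b′ c′ y → y ≡ b ⊎ y ≡ c
      stay (inj₁ refl) e (p , q , r) = case N3.all B e of λ where
        (inj₁ s) → contradiction s p
        (inj₂ (inj₁ s)) → inj₂ s
        (inj₂ (inj₂ s)) → contradiction s q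
      stay (inj₂ refl) e (p , q , r) = case N3.all C e of λ where
        (inj₁ s) → contradiction s p
        (inj₂ (inj₁ s)) → inj₁ s
        (inj₂ (inj₂ s)) → contradiction s r
      apart : ∀ {x} → x ≡ b ⊎ x ≡ c → ¬ R w x
      apart x∈ r with reach-closed {Q = λ x → x ≡ b ⊎ x ≡ c} stay x∈ (reach-sym r)
      ... | inj₁ e = w≢b e
      ... | inj₂ e = w≢c e
      a′→w : R a′ w
      a′→w with near out
      ... | inj₁ r = contradiction r (apart (inj₁ refl))
      ... | inj₂ (inj₁ r) = contradiction r (apart (inj₂ refl))
      ... | inj₂ (inj₂ r) = reach-sym r
      slack : ∀ {t} → Out a b′ c′ t → ∃ λ s → TwoOf a b′ c′ s × R t s
      slack o with near o
      ... | inj₁ r = b , inj₁ (N3.ax B , N3.az B) , r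
      ... | inj₂ (inj₁ r) = c , inj₂ (inj₁ (N3.ax C , N3.az C)) , r
      ... | inj₂ (inj₂ r) = w , two , reach-trans r a′→w

    -- Walks off `b′` and `a₁` lead to `b` or enter `a` from `b`, `c` or `a′`. Here `b` sees `a` and
    -- `b′`, `c` is adjacent to `b`, and `a′` sees `a` and `a₁`.
    tri-link : ∀ {a₁} → a′ ~ a₁ → a₁ ≢ a → a₁ ≢ b′ → a₁ ≁ b′ → Good a a₁ × Joined a b′ a a₁
    tri-link {a₁} a′~a₁ a₁≢a a₁≢b′ a₁≁b′ = ga , mono-joined gb ga (mono-triple indep slack)
      where
      gb : Good a b′
      gb = tri-good T
      a′≁b : a′ ≁ b
      a′≁b e = case N3.all B (~-sym e) of λ where
        (inj₁ p) → ~⇒≢ (N3.az A) (≡-sym p)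
        (inj₂ (inj₁ p)) → N3.y≢z A (≡-sym p)
        (inj₂ (inj₂ p)) → a′≢b′ p
      a′≁c : a′ ≁ c
      a′≁c e = case N3.all C (~-sym e) of λ where
        (inj₁ p) → ~⇒≢ (N3.az A) (≡-sym p)
        (inj₂ (inj₁ p)) → N3.x≢z A (≡-sym p)
        (inj₂ (inj₂ p)) → a′≢c′ p
      b≢a₁ : b ≢ a₁
      b≢a₁ refl = a′≁b a′~a₁
      c≢a₁ : c ≢ a₁
      c≢a₁ refl = a′≁c a′~a₁
      ga : Good a a₁
      ga = good (≢-sym a₁≢a) (λ e → case N3.all A e of λ where
          (inj₁ p) → b≢a₁ (≡-sym p)
          (inj₂ (inj₁ p)) → c≢a₁ (≡-sym p)
          (inj₂ (inj₂ p)) → ~⇒≢ a′~a₁ (≡-sym p)) (~-sym (N3.az A)) a′~a₁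
      indep : Independent a b′ a₁
      indep = independent (Good.x≢y gb) (≢-sym a₁≢a) (≢-sym a₁≢b′) (Good.x≁y gb) (Good.x≁y ga) (a₁≁b′ ∘ ~-sym)
      slack : ∀ {t} → Out a b′ a₁ t → ∃ λ s → TwoOf a b′ a₁ s × Reach G (Out a b′ a₁) t s
      slack (t≢a , t≢b′ , t≢a₁)
        with first-hit (_≟ a) (connected₂ b′ a₁ t≢b′ t≢a₁ (~⇒≢ (N3.az B)) b≢a₁) t≢a
      ... | inj₁ r = b , inj₁ (N3.ax B , N3.az B) , reach-map (λ ((p , q) , s) → s , p , q) r
      ... | inj₂ (m , _ , r , m~a , _ , refl) with N3.all A (~-sym m~a)
      ...   | inj₁ refl = b , inj₁ (N3.ax B , N3.az B) , reach-map (λ ((p , q) , s) → s , p , q) r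
      ...   | inj₂ (inj₁ refl) = b , inj₁ (N3.ax B , N3.az B) ,
                reach-snoc (reach-map (λ ((p , q) , s) → s , p , q) r) (N3.ay C)
                  (~⇒≢ (N3.ax B) , ~⇒≢ (N3.az B) , b≢a₁)
      ...   | inj₂ (inj₂ refl) = a′ , inj₂ (inj₁ (~-sym (N3.az A) , a′~a₁)) ,
                reach-map (λ ((p , q) , s) → s , p , q) r

  tri-common : ∀ {a b c a′ b′ c′} → Tri a b c a′ b′ c′ → b′ ≁ c′ → ∀ {w} → w ~ b′ → w ~ c′ → AllEquivalent
  tri-common T b′≁c′ w~b′ w~c′ = tri-mono T b′≁c′
      (λ { refl → case N3.all B w~c′ of λ where
        (inj₁ e) → N3.x≢z C (≡-sym e)
        (inj₂ (inj₁ e)) → ~⇒≢ (N3.az C) (≡-sym e)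
        (inj₂ (inj₂ e)) → b′≢c′ (≡-sym e) })
      (λ { refl → case N3.all C w~b′ of λ where
        (inj₁ e) → N3.x≢z B (≡-sym e)
        (inj₂ (inj₁ e)) → ~⇒≢ (N3.az B) (≡-sym e)
        (inj₂ (inj₂ e)) → b′≢c′ e })
      ((λ { refl → Good.x≁y (tri-good T) w~b′ }) , ~⇒≢ w~b′ , ~⇒≢ w~c′) (inj₂ (inj₂ (w~b′ , w~c′)))
    where open Tri T

  tri-adjacent : ∀ {a b c a′ b′ c′} → Tri a b c a′ b′ c′ → b′ ≁ c′ → a′ ~ b′ → AllEquivalent
  tri-adjacent T b′≁c′ a′~b′ = tri-mono T b′≁c′ (≢-sym (N3.x≢z A)) (≢-sym (N3.y≢z A))
      (≢-sym (~⇒≢ (N3.az A)) , a′≢b′ , a′≢c′) (inj₁ (~-sym (N3.az A) , a′~b′))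
    where open Tri T

  -- Without an edge from `a′` to `b′` or `c′`, a further neighbour `a₁` of `a′` either shares a
  -- neighbourhood that `tri-common` exploits, or the class of `a` and `a₁` mediates between those
  -- of `b′` and `c′`.
  tri-nonadjacent : ∀ {a b c a′ b′ c′} → Tri a b c a′ b′ c′ → b′ ≁ c′ → AllEquivalent
  tri-nonadjacent {a} {b} {c} {a′} {b′} {c′} T b′≁c′ with adj? G a′ b′ | adj? G a′ c′
  ... | yes e | _ = tri-adjacent T b′≁c′ e
  ... | no _ | yes e = tri-adjacent (tri-flip T) (b′≁c′ ∘ ~-sym) e
  ... | no a′≁b′ | no a′≁c′ with nbhd-with₁ (~-sym (N3.az (Tri.A T)))
  ...   | a₁ , _ , N with adj? G a₁ b′ | adj? G a₁ c′
  ...     | yes e | _ = tri-common (tri-swap (tri-flip T)) a′≁b′ (~-sym (N3.ay N)) e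
  ...     | no _ | yes e = tri-common (tri-swap T) a′≁c′ (~-sym (N3.ay N)) e
  ...     | no a₁≁b′ | no a₁≁c′ = tri-joined T (joined-trans (proj₁ lc) (proj₂ lc) (joined-sym (proj₂ lb)))
    where
    lb = tri-link T (N3.ay N) (≢-sym (N3.x≢y N)) (λ { refl → a′≁b′ (N3.ay N) }) a₁≁b′
    lc = tri-link (tri-flip T) (N3.ay N) (≢-sym (N3.x≢y N)) (λ { refl → a′≁c′ (N3.ay N) }) a₁≁c′

  tri-equivalent : ¬ IsoTo G (Fin 2 × Fin 3) PrismAdj → ∀ {a b c a′ b′ c′} →
    Tri a b c a′ b′ c′ → AllEquivalent
  tri-equivalent not-prism {a} {b} {c} {a′} {b′} {c′} T with adj? G a′ b′ | adj? G a′ c′ | adj? G b′ c′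
  ... | no ne | _ | _ = tri-nonadjacent (tri-swap (tri-flip T)) ne
  ... | _ | no ne | _ = tri-nonadjacent (tri-swap T) ne
  ... | _ | _ | no ne = tri-nonadjacent T ne
  ... | yes ab | yes ac | yes bc = contradiction
          (iso-prism connected A B C
            (nbhd-with₃ ab ac (~-sym (N3.az A)) b′≢c′ (Good.x≢y (good-sym (tri-good T)))
              (Good.x≢y (good-sym (tri-good (tri-flip T)))))
            (nbhd-with₃ (~-sym ab) bc (~-sym (N3.az B)) a′≢c′ (≢-sym (N3.x≢z A)) (≢-sym (N3.y≢z C)))
            (nbhd-with₃ (~-sym ac) (~-sym bc) (~-sym (N3.az C)) a′≢b′ (≢-sym (N3.y≢z A)) (≢-sym (N3.y≢z B))))
          not-prism
    where
    open Tri T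

  triangle : ¬ IsoTo G (Fin 4) K4Adj → ¬ IsoTo G (Fin 2 × Fin 3) PrismAdj →
    ∀ {a b c} → a ~ b → a ~ c → b ~ c → AllEquivalent
  triangle not-K4 not-prism {a} {b} {c} ab ac bc
    with nbhd-with₂ ab ac (~⇒≢ bc) | nbhd-with₂ (~-sym ab) bc (~⇒≢ ac)
       | nbhd-with₂ (~-sym ac) (~-sym bc) (~⇒≢ ab)
  ... | a′ , A | b′ , B | c′ , C with a′ ≟ b′ | a′ ≟ c′ | b′ ≟ c′
  ... | yes refl | _ | _ = diamond not-K4 A B
  ... | no _ | yes refl | _ = diamond not-K4 (N3-swap₁₂ A) C
  ... | no _ | no _ | yes refl = diamond not-K4 (N3-swap₁₂ B) (N3-swap₁₂ C)
  ... | no ab′ | no ac′ | no bc′ = tri-equivalent not-prism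
          (record { A = A ; B = B ; C = C ; a′≢b′ = ab′ ; a′≢c′ = ac′ ; b′≢c′ = bc′ })

-- Records that a walk stays in one component, so that a vertex in another component can be added to
-- those it avoids.
reach-trace : ∀ {n} {G : Graph n} {P : Fin n → Set} {u v} → Reach G P u v →
  Reach G (λ x → P x × Reach G P u x) u v
reach-trace (here p) = here (p , here p)
reach-trace (step p a r) =
  step (p , here p) a (reach-map (λ (q , s) → q , step p a s) (reach-trace r))

-- Triangle-free graphs

module TriangleFree {n : ℕ} (G : Graph n) (L : ListAssignment n)
  (reg : Regular G 3) (conn : KConnected G 3) (assign : IsKAssignment 3 L)
  (same : ∀ {v w c} → c ∈ L v → c ∈ L w)
  (tf : ∀ {a b c} → Adj G a b → Adj G a c → ¬ Adj G b c) where

  open Cubic G L reg conn assign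
  open Equal G L reg conn assign same

  nbhd-independent : ∀ {v x y z} → N3 G v x y z → Independent x y z
  nbhd-independent N = independent x≢y x≢z y≢z (tf ax ay) (tf ax az) (tf ay az)
    where open N3 N

  -- Four-cycles

  -- The triple is the neighbourhood `v`, `w`, `k` of `x`. Once `x` and `k` are deleted, `v` and `w`
  -- can only be entered from `y` or `z`, which see both.
  four-cycle-K₂₃ : ∀ {v w x y z} → N3 G v x y z → N3 G w x y z → v ≢ w → AllEquivalent
  four-cycle-K₂₃ {v} {w} {x} {y} {z} V W v≢w with nbhd-with₂ (~-sym (N3.ax V)) (~-sym (N3.ax W)) v≢w
  ... | k , X = mono-claw X (nbhd-independent X) (mono-triple (nbhd-independent X) slack)
    where
    y≢k : y ≢ k
    y≢k refl = tf (N3.ax V) (N3.ay V) (N3.az X)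
    weaken : ∀ {t} → (t ≢ x × t ≢ k) × ¬ (t ≡ v ⊎ t ≡ w) → Out v w k t
    weaken ((_ , p) , q) = q ∘ inj₁ , q ∘ inj₂ , p
    at-y : TwoOf v w k y
    at-y = inj₁ (~-sym (N3.ay V) , ~-sym (N3.ay W))
    at-z : TwoOf v w k z
    at-z = inj₁ (~-sym (N3.az V) , ~-sym (N3.az W))
    slack : ∀ {t} → Out v w k t → ∃ λ s → TwoOf v w k s × Reach G (Out v w k) t s
    slack {t} o@(t≢v , t≢w , t≢k) with t ≟ x
    ... | yes refl = x , inj₁ (N3.ax X , N3.ay X) , here o
    ... | no t≢x with first-hit (λ m → (m ≟ v) ⊎-dec (m ≟ w))
                  (connected₂ x k t≢x t≢k (≢-sym (N3.x≢y V)) y≢k) [ t≢v , t≢w ]′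
    ...   | inj₁ r = y , at-y , reach-map weaken r
    ...   | inj₂ (m , _ , r , e , _ , inj₁ refl) = case N3.all V (~-sym e) of λ where
              (inj₁ refl) → contradiction refl (proj₁ (proj₁ (reach-target r)))
              (inj₂ (inj₁ refl)) → y , at-y , reach-map weaken r
              (inj₂ (inj₂ refl)) → z , at-z , reach-map weaken r
    ...   | inj₂ (m , _ , r , e , _ , inj₂ refl) = case N3.all W (~-sym e) of λ where
              (inj₁ refl) → contradiction refl (proj₁ (proj₁ (reach-target r)))
              (inj₂ (inj₁ refl)) → y , at-y , reach-map weaken r
              (inj₂ (inj₂ refl)) → z , at-z , reach-map weaken r

  -- Walks off `x` and `z` aim at `w′`, next to `w`. If they meet `y`, they do so from `v` or `w`,
  -- which see both `x` and `y`, or from `l`, whence the given walk leads back to `w′`.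
  four-cycle-reach : ∀ {v w x y z w′ l} → N3 G v x y z → N3 G w x y w′ → w ≁ z → N3 G y v w l →
    Reach G (Out x y z) w′ l → AllEquivalent
  four-cycle-reach {v} {w} {x} {y} {z} {w′} {l} V W w≁z Y w′→l =
      mono-claw V (nbhd-independent V) (mono-triple (nbhd-independent V) slack)
    where
    weaken : ∀ {t} → (t ≢ x × t ≢ z) × t ≢ y → Out x y z t
    weaken ((p , q) , r) = p , r , q
    w-out : Out x y z w
    w-out = ~⇒≢ (N3.ax W) , ~⇒≢ (N3.ay W) , λ { refl → tf (N3.ay V) (N3.az V) (~-sym (N3.ay W)) }
    at-w : TwoOf x y z w
    at-w = inj₁ (N3.ax W , N3.ay W)
    slack : ∀ {t} → Out x y z t → ∃ λ s → TwoOf x y z s × Reach G (Out x y z) t s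
    slack (t≢x , t≢y , t≢z)
      with first-hit (_≟ y) (connected₂ x z t≢x t≢z (≢-sym (N3.x≢z W)) (λ { refl → w≁z (N3.az W) })) t≢y
    ... | inj₁ r = w , at-w , reach-snoc (reach-map weaken r) (~-sym (N3.az W)) w-out
    ... | inj₂ (m , _ , r , e , _ , refl) = case N3.all Y (~-sym e) of λ where
      (inj₁ refl) → v , inj₁ (N3.ax V , N3.ay V) , reach-map weaken r
      (inj₂ (inj₁ refl)) → w , at-w , reach-map weaken r
      (inj₂ (inj₂ refl)) → w , at-w ,
        reach-snoc (reach-trans (reach-map weaken r) (reach-sym w′→l)) (~-sym (N3.az W)) w-out

  four-cycle : ∀ {v w x y z} → N3 G v x y z → v ≢ w → w ~ x → w ~ y → AllEquivalent
  four-cycle {v} {w} {x} {y} {z} V v≢w w~x w~y with nbhd-with₂ w~x w~y (N3.x≢y V)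
  ... | w′ , W with w′ ≟ z
  ...   | yes refl = four-cycle-K₂₃ V W v≢w
  ...   | no w′≢z with nbhd-with₂ (~-sym (N3.ax V)) (~-sym w~x) v≢w | nbhd-with₂ (~-sym (N3.ay V)) (~-sym w~y) v≢w
  ...     | k , X | l , Y = case reaches of λ where
              (inj₁ r) → four-cycle-reach (N3-swap₁₂ V) (N3-swap₁₂ W) w≁z X
                           (reach-map (λ (p , q , s) → q , p , s) r)
              (inj₂ r) → four-cycle-reach V W w≁z Y r
    where
    w≁z : w ≁ z
    w≁z e = case N3.all W e of λ where
      (inj₁ p) → N3.x≢z V (≡-sym p)
      (inj₂ (inj₁ p)) → N3.y≢z V (≡-sym p)
      (inj₂ (inj₂ p)) → w′≢z (≡-sym p)
    weaken : ∀ {t} → (t ≢ w × t ≢ z) × ¬ (t ≡ x ⊎ t ≡ y) → Out x y z t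
    weaken ((_ , p) , q) = q ∘ inj₁ , q ∘ inj₂ , p
    not-v : ¬ Reach G (Out x y z) w′ v
    not-v r = tf w~x (N3.az W) (subst (x ~_) (≡-sym w′≡v) (~-sym (N3.ax V)))
      where
      w′≡v : w′ ≡ v
      w′≡v = reach-closed {Q = _≡ v} (λ { refl e (p , q , s) → case N3.all V e of λ where
        (inj₁ c) → contradiction c p
        (inj₂ (inj₁ c)) → contradiction c q
        (inj₂ (inj₂ c)) → contradiction c s }) refl (reach-sym r)
    -- Off `w` and `z` a walk from `w′` gets to `v`, but `v` has no neighbour besides `x`, `y`, `z`.
    -- So the walk must first meet `x` or `y`, and it comes from `k` or `l`.
    reaches : Reach G (Out x y z) w′ k ⊎ Reach G (Out x y z) w′ l
    reaches with first-hit (λ m → (m ≟ x) ⊎-dec (m ≟ y))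
        (connected₂ w z (≢-sym (~⇒≢ (N3.az W))) w′≢z v≢w (~⇒≢ (N3.az V)))
        [ ≢-sym (N3.x≢z W) , ≢-sym (N3.y≢z W) ]′
    ... | inj₁ r = contradiction (reach-map weaken r) not-v
    ... | inj₂ (m , _ , r , e , _ , inj₁ refl) = case N3.all X (~-sym e) of λ where
            (inj₁ refl) → contradiction (reach-map weaken r) not-v
            (inj₂ (inj₁ refl)) → contradiction refl (proj₁ (proj₁ (reach-target r)))
            (inj₂ (inj₂ refl)) → inj₁ (reach-map weaken r)
    ... | inj₂ (m , _ , r , e , _ , inj₂ refl) = case N3.all Y (~-sym e) of λ where
            (inj₁ refl) → contradiction (reach-map weaken r) not-v
            (inj₂ (inj₁ refl)) → contradiction refl (proj₁ (proj₁ (reach-target r)))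
            (inj₂ (inj₂ refl)) → inj₂ (reach-map weaken r)

  -- Girth at least five

  module Girth5 (qf : ∀ {a b c d} → a ≢ c → a ~ b → b ~ c → a ~ d → d ~ c → b ≡ d) where

    -- Negated, it says that `u`, `a`, `b` form a cut that separates `r` from both `s` and `t`.
    Through : (u a b r s t : Fin n) → Set
    Through u a b r s t = Reach G (Out u a b) r s ⊎ Reach G (Out u a b) r t

    through? : ∀ u a b r s t → Dec (Through u a b r s t)
    through? u a b r s t = reach? G out? r s ⊎-dec reach? G out? r t
      where
      out? : Decidable (Out u a b)
      out? w = ¬? (w ≟ u) ×-dec (¬? (w ≟ a) ×-dec ¬? (w ≟ b))

    outer-good : ∀ {u s a} → s ~ u → s ~ a → a ≢ u → Good u a
    outer-good s~u s~a a≢u = good (≢-sym a≢u) (tf s~u s~a) s~u s~a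

    outer≢ : ∀ {u s t a b} → u ~ s → u ~ t → s ≢ t → s ~ a → a ≢ u → t ~ b → a ≢ b
    outer≢ u~s u~t s≢t s~a a≢u t~b refl = s≢t (qf (≢-sym a≢u) u~s s~a u~t t~b)

    mid≢outer : ∀ {u s t b} → u ~ s → u ~ t → t ~ b → s ≢ b
    mid≢outer u~s u~t t~b refl = tf u~t u~s t~b

    -- A walk off `a` and `b` reaches `s` or enters `u` from a neighbour. Both `s` and `t` see two
    -- members of the triple `u`, `a`, `b`; only arrival from `r` needs help, which `Through` gives.
    link : ∀ {u s t r a b} → N3 G u s t r → s ~ a → a ≢ u → t ~ b → b ≢ u → a ≁ b →
      Through u a b r s t → Joined u a u b
    link {u} {s} {t} {r} {a} {b} U s~a a≢u t~b b≢u a≁b third =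
        mono-joined ga gb (mono-triple indep slack)
      where
      ga : Good u a
      ga = outer-good (~-sym (N3.ax U)) s~a a≢u
      gb : Good u b
      gb = outer-good (~-sym (N3.ay U)) t~b b≢u
      indep : Independent u a b
      indep = independent (≢-sym a≢u) (≢-sym b≢u) (outer≢ (N3.ax U) (N3.ay U) (N3.x≢y U) s~a a≢u t~b)
        (Good.x≁y ga) (Good.x≁y gb) a≁b
      weaken : ∀ {w} → (w ≢ a × w ≢ b) × w ≢ u → Out u a b w
      weaken ((p , q) , o) = o , p , q
      at-s : TwoOf u a b s
      at-s = inj₁ (~-sym (N3.ax U) , s~a)
      at-t : TwoOf u a b t
      at-t = inj₂ (inj₁ (~-sym (N3.ay U) , t~b))
      slack : ∀ {w} → Out u a b w → ∃ λ x → TwoOf u a b x × Reach G (Out u a b) w x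
      slack (w≢u , w≢a , w≢b)
        with first-hit (_≟ u) (connected₂ a b w≢a w≢b (~⇒≢ s~a) (mid≢outer (N3.ax U) (N3.ay U) t~b)) w≢u
      ... | inj₁ p = s , at-s , reach-map weaken p
      ... | inj₂ (m , _ , p , e , _ , refl) = case N3.all U (~-sym e) of λ where
        (inj₁ refl) → s , at-s , reach-map weaken p
        (inj₂ (inj₁ refl)) → t , at-t , reach-map weaken p
        (inj₂ (inj₂ refl)) → case third of λ where
          (inj₁ q) → s , at-s , reach-trans (reach-map weaken p) q
          (inj₂ q) → t , at-t , reach-trans (reach-map weaken p) q

    -- The ball of radius two around `u`, a tree on ten distinct vertices apart from edges between
    -- leaves. The leaves `y` and `z` are to be compared; the `w`s serve as intermediate stations.
    record Spider (u v p r y z w₁ w₂ w₃ w₄ : Fin n) : Set where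
      field
        U : N3 G u v p r
        V : N3 G v u y z
        P : N3 G p u w₁ w₂
        R : N3 G r u w₃ w₄

    swap-yz : ∀ {u v p r y z w₁ w₂ w₃ w₄} →
      Spider u v p r y z w₁ w₂ w₃ w₄ → Spider u v p r z y w₁ w₂ w₃ w₄
    swap-yz S = record { U = U ; V = N3-swap₂₃ V ; P = P ; R = R }
      where open Spider S

    swap-w₁w₂ : ∀ {u v p r y z w₁ w₂ w₃ w₄} →
      Spider u v p r y z w₁ w₂ w₃ w₄ → Spider u v p r y z w₂ w₁ w₃ w₄
    swap-w₁w₂ S = record { U = U ; V = V ; P = N3-swap₂₃ P ; R = R }
      where open Spider S

    swap-w₃w₄ : ∀ {u v p r y z w₁ w₂ w₃ w₄} →
      Spider u v p r y z w₁ w₂ w₃ w₄ → Spider u v p r y z w₁ w₂ w₄ w₃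
    swap-w₃w₄ S = record { U = U ; V = V ; P = P ; R = N3-swap₂₃ R }
      where open Spider S

    swap-pr : ∀ {u v p r y z w₁ w₂ w₃ w₄} →
      Spider u v p r y z w₁ w₂ w₃ w₄ → Spider u v r p y z w₃ w₄ w₁ w₂
    swap-pr S = record { U = N3-swap₂₃ U ; V = V ; P = R ; R = P }
      where open Spider S

    module Leaves {u v p r y z w₁ w₂ w₃ w₄} (S : Spider u v p r y z w₁ w₂ w₃ w₄) where
      open Spider S public
      u~v = N3.ax U
      u~p = N3.ay U
      u~r = N3.az U
      v~y = N3.ay V
      v~z = N3.az V
      p~w₁ = N3.ay P
      p~w₂ = N3.az P
      r~w₃ = N3.ay R
      r~w₄ = N3.az R
      y≢u = ≢-sym (N3.x≢y V)
      z≢u = ≢-sym (N3.x≢z V)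
      w₁≢u = ≢-sym (N3.x≢y P)
      w₂≢u = ≢-sym (N3.x≢z P)
      w₃≢u = ≢-sym (N3.x≢y R)
      w₄≢u = ≢-sym (N3.x≢z R)
      v≢u = ≢-sym (~⇒≢ u~v)
      p≢u = ≢-sym (~⇒≢ u~p)
      r≢u = ≢-sym (~⇒≢ u~r)
      y≢w₁ = outer≢ u~v u~p (N3.x≢y U) v~y y≢u p~w₁
      y≢w₂ = outer≢ u~v u~p (N3.x≢y U) v~y y≢u p~w₂
      y≢w₃ = outer≢ u~v u~r (N3.x≢z U) v~y y≢u r~w₃
      y≢w₄ = outer≢ u~v u~r (N3.x≢z U) v~y y≢u r~w₄
      z≢w₁ = outer≢ u~v u~p (N3.x≢y U) v~z z≢u p~w₁
      z≢w₂ = outer≢ u~v u~p (N3.x≢y U) v~z z≢u p~w₂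
      z≢w₃ = outer≢ u~v u~r (N3.x≢z U) v~z z≢u r~w₃
      z≢w₄ = outer≢ u~v u~r (N3.x≢z U) v~z z≢u r~w₄
      w₁≢w₃ = outer≢ u~p u~r (N3.y≢z U) p~w₁ w₁≢u r~w₃
      w₁≢w₄ = outer≢ u~p u~r (N3.y≢z U) p~w₁ w₁≢u r~w₄
      w₂≢w₄ = outer≢ u~p u~r (N3.y≢z U) p~w₂ w₂≢u r~w₄
      v≢w₁ = mid≢outer u~v u~p p~w₁
      v≢w₂ = mid≢outer u~v u~p p~w₂
      v≢w₃ = mid≢outer u~v u~r r~w₃
      v≢w₄ = mid≢outer u~v u~r r~w₄
      p≢y = mid≢outer u~p u~v v~y
      p≢z = mid≢outer u~p u~v v~z
      p≢w₃ = mid≢outer u~p u~r r~w₃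
      p≢w₄ = mid≢outer u~p u~r r~w₄
      r≢y = mid≢outer u~r u~v v~y
      r≢z = mid≢outer u~r u~v v~z
      r≢w₁ = mid≢outer u~r u~p p~w₁
      r≢w₂ = mid≢outer u~r u~p p~w₂
      good-w₁ = outer-good (~-sym u~p) p~w₁ w₁≢u
      good-w₂ = outer-good (~-sym u~p) p~w₂ w₂≢u
      good-w₃ = outer-good (~-sym u~r) r~w₃ w₃≢u
      good-w₄ = outer-good (~-sym u~r) r~w₄ w₄≢u

    -- {u, y, w₁} separates r from v and p; K is the component of r.
    module Cut {u v p r y z w₁ w₂ w₃ w₄} (S : Spider u v p r y z w₁ w₂ w₃ w₄)
               (cut : ¬ Through u y w₁ r v p) where
      open Leaves S

      O K : Fin n → Set
      O = Out u y w₁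
      K = Reach G O r

      K? : Decidable K
      K? = reach? G (λ w → ¬? (w ≟ u) ×-dec (¬? (w ≟ y) ×-dec ¬? (w ≟ w₁))) r

      O-v : O v
      O-v = v≢u , ~⇒≢ v~y , v≢w₁
      O-p : O p
      O-p = p≢u , p≢y , ~⇒≢ p~w₁
      O-r : O r
      O-r = r≢u , r≢y , r≢w₁
      O-z : O z
      O-z = z≢u , ≢-sym (N3.y≢z V) , z≢w₁
      O-w₂ : O w₂
      O-w₂ = w₂≢u , ≢-sym y≢w₂ , ≢-sym (N3.y≢z P)
      K-r : K r
      K-r = here O-r
      ¬K-v : ¬ K v
      ¬K-v = cut ∘ inj₁
      ¬K-p : ¬ K p
      ¬K-p = cut ∘ inj₂
      ¬K-z : ¬ K z
      ¬K-z k = ¬K-v (reach-snoc k (~-sym v~z) O-v)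
      ¬K-w₂ : ¬ K w₂
      ¬K-w₂ k = ¬K-p (reach-snoc k (~-sym p~w₂) O-p)
      K-w₃ : K w₃
      K-w₃ = reach-snoc K-r r~w₃ (w₃≢u , ≢-sym y≢w₃ , ≢-sym w₁≢w₃)
      K-w₄ : K w₄
      K-w₄ = reach-snoc K-r r~w₄ (w₄≢u , ≢-sym y≢w₄ , ≢-sym w₁≢w₄)

      -- Two vertices do not separate the graph: off `u` and `y` the vertex `r` still reaches `v`,
      -- and only `w₁` can let it out of `K`.
      w₁-meets-K : ∃ λ k → K k × w₁ ~ k
      w₁-meets-K with first-hit (_≟ w₁) (connected₂ u y r≢u r≢y v≢u (~⇒≢ v~y)) r≢w₁
      ... | inj₁ q = contradiction (reach-map (λ ((a , b) , c) → a , b , c) q) ¬K-v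
      ... | inj₂ (m , _ , q , e , _ , refl) = m , reach-map (λ ((a , b) , c) → a , b , c) q , ~-sym e

      -- The walk from `v` to `p` off `u` and `y` stays outside `K`, hence off `w₃`, until it meets
      -- `w₁`; from there one edge leads to `p`.
      y-link-w₃ : y ≁ w₃ → Joined u y u w₃
      y-link-w₃ y≁w₃ = link (N3-swap₂₃ U) v~y y≢u r~w₃ w₃≢u y≁w₃ (inj₁ (reach-sym v→p))
        where
        avoid : ∀ {x} → Reach G (λ w → (w ≢ u × w ≢ y) × w ≢ w₁) v x → Reach G (Out u y w₃) v x
        avoid q = reach-map (λ (((a , b) , c) , s) → a , b , λ { refl →
            ¬K-v (reach-trans K-w₃ (reach-sym (reach-map (λ ((a , b) , c) → a , b , c) s))) })
          (reach-trace q)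
        v→p : Reach G (Out u y w₃) v p
        v→p with first-hit (_≟ w₁) (connected₂ u y v≢u (~⇒≢ v~y) p≢u p≢y) v≢w₁
        ... | inj₁ q = avoid q
        ... | inj₂ (m , _ , q , e , _ , refl) =
          reach-snoc (reach-snoc (avoid q) e (w₁≢u , ≢-sym y≢w₁ , w₁≢w₃)) (~-sym p~w₁) (p≢u , p≢y , p≢w₃)

      -- From `p` the edge through `w₁` enters `K` at `k`. Off `w₁` and `w₃` a walk then reaches `r`
      -- inside `K`, or leaves `K` through `y` and so reaches `v`. The vertex `z` lies outside `K`.
      w₃-link-z : (∃ λ k → K k × w₁ ~ k × k ≢ w₃) → Joined u w₃ u z
      w₃-link-z (k , Kk , w₁~k , k≢w₃) = link (N3-rot (N3-rot U))
          r~w₃ w₃≢u v~z z≢u (λ e → ¬K-z (reach-snoc K-w₃ e O-z)) (swap through)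
        where
        Z : Fin n → Set
        Z = Out u w₃ z
        Z-p : Z p
        Z-p = p≢u , p≢w₃ , p≢z
        Z-w₁ : Z w₁
        Z-w₁ = w₁≢u , w₁≢w₃ , ≢-sym z≢w₁
        Q : Fin n → Set
        Q w = (w ≢ w₁ × w ≢ w₃) × ¬ (w ≡ u ⊎ w ≡ y)
        toO : ∀ {x} → Q x → O x
        toO ((a , _) , c) = c ∘ inj₁ , c ∘ inj₂ , a
        inK : ∀ {x} → Reach G Q k x → K x
        inK q = reach-trans Kk (reach-map toO q)
        avoid : ∀ {x} → Reach G Q k x → Reach G Z k x
        avoid q = reach-map (λ (((_ , b) , c) , s) → c ∘ inj₁ , b , λ { refl → ¬K-z (inK s) })
          (reach-trace q)
        from-p : ∀ {x} → Reach G Z k x → Reach G Z p x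
        from-p q = step Z-p p~w₁ (step Z-w₁ w₁~k q)
        k-out : O k
        k-out = reach-target Kk
        through : Through u w₃ z p v r
        through with first-hit (λ x → (x ≟ u) ⊎-dec (x ≟ y))
            (connected₂ w₁ w₃ (proj₂ (proj₂ k-out)) k≢w₃ r≢w₁ (~⇒≢ r~w₃))
            [ proj₁ k-out , proj₁ (proj₂ k-out) ]′
        ... | inj₁ q = inj₂ (from-p (avoid q))
        ... | inj₂ (m , _ , q , e , _ , inj₁ refl) = case N3.all U (~-sym e) of λ where
                (inj₁ refl) → contradiction (inK q) ¬K-v
                (inj₂ (inj₁ refl)) → contradiction (inK q) ¬K-p
                (inj₂ (inj₂ refl)) → inj₂ (from-p (avoid q))
        ... | inj₂ (m , _ , q , e , _ , inj₂ refl) = inj₁ (from-p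
                (reach-snoc (reach-snoc (avoid q) e (y≢u , y≢w₃ , N3.y≢z V)) (~-sym v~y)
                  (v≢u , v≢w₃ , ~⇒≢ v~z)))

      -- The third neighbour `e` of `w₁` is not in `K`. If it is not `y`, a walk from `e` off `w₁`
      -- and `w₂` gets to `v` or `y` without meeting `w₄`, which is in `K`; the edges at `w₁`
      -- complete the connection to `p`.
      w₂-link-w₄ : w₁ ~ w₃ → (∀ {k} → K k → w₁ ~ k → k ≡ w₃) → Joined u w₂ u w₄
      w₂-link-w₄ w₁~w₃ only = link (N3-rot U) p~w₂ w₂≢u r~w₄ w₄≢u
          (λ e → ¬K-w₂ (reach-snoc K-w₄ (~-sym e) O-w₂)) (inj₁ v→p)
        where
        Z : Fin n → Set
        Z = Out u w₂ w₄
        Z-v : Z v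
        Z-v = v≢u , v≢w₂ , v≢w₄
        Z-y : Z y
        Z-y = y≢u , y≢w₂ , y≢w₄
        Z-w₁ : Z w₁
        Z-w₁ = w₁≢u , N3.y≢z P , w₁≢w₄
        Z-p : Z p
        Z-p = p≢u , ~⇒≢ p~w₂ , p≢w₄
        v→p : Reach G Z v p
        v→p with nbhd-with₂ (~-sym p~w₁) w₁~w₃ p≢w₃
        ... | e , W with e ≟ y
        ...   | yes refl = step Z-v v~y (step Z-y (~-sym (N3.az W)) (step Z-w₁ (~-sym p~w₁) (here Z-p)))
        ...   | no e≢y with first-hit (λ x → (x ≟ u) ⊎-dec (x ≟ y))
                    (connected₂ w₁ w₂ (≢-sym (~⇒≢ (N3.az W))) e≢w₂ v≢w₁ v≢w₂) [ e≢u , e≢y ]′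
          where
          e≢w₂ : e ≢ w₂
          e≢w₂ refl = tf p~w₁ p~w₂ (N3.az W)
          e≢u : e ≢ u
          e≢u refl = tf (~-sym u~p) p~w₁ (~-sym (N3.az W))
        ...     | hit = finish hit
          where
          Q : Fin n → Set
          Q w = (w ≢ w₁ × w ≢ w₂) × ¬ (w ≡ u ⊎ w ≡ y)
          toO : ∀ {x} → Q x → O x
          toO ((a , _) , c) = c ∘ inj₁ , c ∘ inj₂ , a
          ¬K-e : ∀ {x} → Reach G Q e x → ¬ K x
          ¬K-e q Kx = N3.y≢z W (≡-sym (only (reach-trans Kx (reach-sym (reach-map toO q))) (N3.az W)))
          avoid : ∀ {x} → Reach G Q e x → Reach G Z e x
          avoid q = reach-map (λ (((_ , b) , c) , s) → c ∘ inj₁ , b , λ { refl → ¬K-e s K-w₄ })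
            (reach-trace q)
          to-p : ∀ {x} → Reach G Z e x → Reach G Z x p
          to-p q = reach-snoc (reach-snoc (reach-sym q) (~-sym (N3.az W)) Z-w₁) (~-sym p~w₁) Z-p
          finish : Reach G Q e v ⊎ (∃ λ m → ∃ λ q → Reach G Q e m × m ~ q × (q ≢ w₁ × q ≢ w₂) × (q ≡ u ⊎ q ≡ y)) →
            Reach G Z v p
          finish (inj₁ q) = to-p (avoid q)
          finish (inj₂ (m , _ , q , a , _ , inj₂ refl)) = step Z-v v~y (step Z-y (~-sym a) (to-p (avoid q)))
          finish (inj₂ (m , _ , q , a , _ , inj₁ refl)) = case N3.all U (~-sym a) of λ where
            (inj₁ refl) → to-p (avoid q)
            -- All neighbours `u`, `w₁`, `w₂` of `p` are excluded, so a walk ending in `p` starts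
            -- there.
            (inj₂ (inj₁ refl)) → contradiction
              (reach-closed {Q = _≡ p} (λ { refl b ((x , x′) , x″) → case N3.all P b of λ where
                (inj₁ c) → contradiction (inj₁ c) x″
                (inj₂ (inj₁ c)) → contradiction c x
                (inj₂ (inj₂ c)) → contradiction c x′ }) refl (reach-sym q))
              (≢-sym (N3.x≢z W))
            (inj₂ (inj₂ refl)) → contradiction K-r (¬K-e q)

    -- Here `w₃` is the only neighbour of `w₁` in `K`, so `w₃` cannot be linked to `z` directly. The
    -- detour runs through `w₃`, `w₂`, `w₄`; the absence of four-cycles gives the missing
    -- nonadjacencies.
    only-one : ∀ {u v p r y z w₁ w₂ w₃ w₄} (S : Spider u v p r y z w₁ w₂ w₃ w₄)
      (cut : ¬ Through u y w₁ r v p) → y ~ w₄ →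
      ¬ (∃ λ k → Cut.K S cut k × w₁ ~ k × k ≢ w₃) → Joined u y u z
    only-one {u} {v} {p} {r} {y} {z} {w₁} {w₂} {w₃} {w₄} S cut y~w₄ none = joined-trans good-w₃ (y-link-w₃ y≁w₃)
        (joined-trans good-w₂ w₃-w₂ (joined-trans good-w₄ (w₂-link-w₄ w₁~w₃ only) w₄-z))
      where
      open Leaves S
      open Cut S cut
      only : ∀ {k} → K k → w₁ ~ k → k ≡ w₃
      only {k} Kk e with k ≟ w₃
      ... | yes p = p
      ... | no ne = contradiction (k , Kk , e , ne) none
      w₁~w₃ : w₁ ~ w₃
      w₁~w₃ = let k , Kk , e = w₁-meets-K in subst (w₁ ~_) (only Kk e) e
      y≁w₃ : y ≁ w₃
      y≁w₃ e = N3.y≢z R (qf r≢y r~w₃ (~-sym e) r~w₄ (~-sym y~w₄))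
      w₃-w₂ : Joined u w₃ u w₂
      w₃-w₂ = link (N3-swap₁₂ (N3-rot U)) r~w₃ w₃≢u p~w₂ w₂≢u
        (λ e → N3.y≢z P (qf p≢w₃ p~w₁ w₁~w₃ p~w₂ (~-sym e)))
        (inj₁ (step (v≢u , v≢w₃ , v≢w₂) v~y (step (y≢u , y≢w₃ , y≢w₂) y~w₄
          (step (w₄≢u , ≢-sym (N3.y≢z R) , ≢-sym w₂≢w₄) (~-sym r~w₄) (here (r≢u , ~⇒≢ r~w₃ , r≢w₂))))))
      w₄-z : Joined u w₄ u z
      w₄-z = Cut.w₃-link-z (swap-w₃w₄ S) cut (w₃ , K-w₃ , w₁~w₃ , N3.y≢z R)

    -- A station `w₃` or `w₄` works if it is not adjacent to `y` and is not the only neighbour of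
    -- `w₁` in `K`. At most one of the two is adjacent to `y` and at most one is that only
    -- neighbour, so both fail only in the situation of `only-one`.
    cut-joined : ∀ {u v p r y z w₁ w₂ w₃ w₄} → Spider u v p r y z w₁ w₂ w₃ w₄ →
      ¬ Through u y w₁ r v p → Joined u y u z
    cut-joined {u} {v} {p} {r} {y} {z} {w₁} {w₂} {w₃} {w₄} S cut =
        by-cases (adj? G y w₃) (adj? G y w₄) (other? w₃) (other? w₄)
      where
      open Leaves S
      module Cut₃ = Cut S cut
      module Cut₄ = Cut (swap-w₃w₄ S) cut
      Other : Fin n → Set
      Other w = ∃ λ k → Cut₃.K k × w₁ ~ k × k ≢ w
      other? : Decidable Other
      other? w = any? λ k → Cut₃.K? k ×-dec (adj? G w₁ k ×-dec ¬? (k ≟ w))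
      by-cases : Dec (y ~ w₃) → Dec (y ~ w₄) → Dec (Other w₃) → Dec (Other w₄) → Joined u y u z
      by-cases (no a) _ (yes k) _ = joined-trans good-w₃ (Cut₃.y-link-w₃ a) (Cut₃.w₃-link-z k)
      by-cases _ (no a) _ (yes k) = joined-trans good-w₄ (Cut₄.y-link-w₃ a) (Cut₄.w₃-link-z k)
      by-cases (yes a) (yes b) _ _ = ⊥-elim (N3.y≢z R (qf r≢y r~w₃ (~-sym a) r~w₄ (~-sym b)))
      by-cases _ (yes b) (no k) _ = only-one S cut b k
      by-cases (yes a) _ _ (no k) = only-one (swap-w₃w₄ S) cut a k
      by-cases (no _) (no _) (no k) (no k′) with Cut₃.w₁-meets-K
      ... | x , Kx , e with x ≟ w₃
      ...   | no ne = ⊥-elim (k (x , Kx , e , ne))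
      ...   | yes refl = ⊥-elim (k′ (x , Kx , e , N3.y≢z R))

    -- The route through `w₁` uses `link` twice. A missing walk means a cut, settled by
    -- `cut-joined`; a forbidden edge from `y` or `z` to `w₁` closes a five-cycle with `p`, `u`,
    -- `v`.
    w₁-blocked : ∀ {u v p r y z w₁ w₂ w₃ w₄} → Spider u v p r y z w₁ w₂ w₃ w₄ →
      Joined u y u z ⊎ (y ~ w₁ ⊎ z ~ w₁)
    w₁-blocked {u} {v} {p} {r} {y} {z} {w₁} S with through? u y w₁ r v p | through? u z w₁ r v p
    ... | no cut | _ = inj₁ (cut-joined S cut)
    ... | yes _ | no cut = inj₁ (joined-sym (cut-joined (swap-yz S) cut))
    ... | yes t | yes t′ with adj? G y w₁ | adj? G z w₁
    ...   | yes a | _ = inj₂ (inj₁ a)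
    ...   | no _ | yes b = inj₂ (inj₂ b)
    ...   | no a | no b = inj₁ (joined-trans good-w₁ (link U v~y y≢u p~w₁ w₁≢u a t)
              (joined-sym (link U v~z z≢u p~w₁ w₁≢u b t′)))
      where open Leaves S

    -- The stations are `w₁` and `w₄`. An edge from `y` to `w₁` or from `w₄` to `z` would close a
    -- four-cycle, and the assumed edges at `y` and `z` provide the walks.
    dense-link : ∀ {u v p r y z w₁ w₂ w₃ w₄} → Spider u v p r y z w₁ w₂ w₃ w₄ →
      y ~ w₂ → y ~ w₄ → z ~ w₁ → z ~ w₃ → w₁ ≁ w₄ → Joined u y u z
    dense-link {u} {v} {p} {r} {y} {z} {w₁} {w₂} {w₃} {w₄} S y~w₂ y~w₄ z~w₁ z~w₃ w₁≁w₄ =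
        joined-trans good-w₁ y-w₁ (joined-trans good-w₄ w₁-w₄ w₄-z)
      where
      open Leaves S
      y-w₁ : Joined u y u w₁
      y-w₁ = link U v~y y≢u p~w₁ w₁≢u (λ e → N3.y≢z P (qf p≢y p~w₁ (~-sym e) p~w₂ (~-sym y~w₂)))
        (inj₁ (step (r≢u , r≢y , r≢w₁) r~w₃ (step (w₃≢u , ≢-sym y≢w₃ , ≢-sym w₁≢w₃) (~-sym z~w₃)
          (step (z≢u , ≢-sym (N3.y≢z V) , z≢w₁) (~-sym v~z) (here (v≢u , ~⇒≢ v~y , v≢w₁))))))
      w₁-w₄ : Joined u w₁ u w₄
      w₁-w₄ = link (N3-rot U) p~w₁ w₁≢u r~w₄ w₄≢u w₁≁w₄
        (inj₁ (step (v≢u , v≢w₁ , v≢w₄) v~y (step (y≢u , y≢w₁ , y≢w₄) y~w₂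
          (step (w₂≢u , ≢-sym (N3.y≢z P) , w₂≢w₄) (~-sym p~w₂) (here (p≢u , ~⇒≢ p~w₁ , p≢w₄))))))
      w₄-z : Joined u w₄ u z
      w₄-z = link (N3-rot (N3-rot U)) r~w₄ w₄≢u v~z z≢u
        (λ e → N3.y≢z R (qf r≢z r~w₃ (~-sym z~w₃) r~w₄ e))
        (inj₂ (step (p≢u , p≢w₄ , p≢z) p~w₂ (step (w₂≢u , w₂≢w₄ , ≢-sym z≢w₂) (~-sym y~w₂)
          (step (y≢u , y≢w₄ , N3.y≢z V) (~-sym v~y) (here (v≢u , v≢w₄ , ~⇒≢ v~z))))))

    -- The Petersen graph: with {u, y, z} and {p, w₃, w₄} coloured, the vertices v, r, w₁, w₂ are slack.
    module Petersen {u v p r y z w₁ w₂ w₃ w₄} (S : Spider u v p r y z w₁ w₂ w₃ w₄)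
        (y~w₂ : y ~ w₂) (y~w₄ : y ~ w₄) (z~w₁ : z ~ w₁) (z~w₃ : z ~ w₃) (w₁~w₄ : w₁ ~ w₄) (w₂~w₃ : w₂ ~ w₃)
        {c d : Colour} (c∈ : c ∈ L u) (d∈ : d ∈ L u) (c≢d : c ≢ d) where
      open Leaves S

      -- Off the neighbourhood `A` of `v` there remains, besides `v`, the six-cycle `p`, `w₁`, `w₄`,
      -- `r`, `w₃`, `w₂`, none of whose vertices sees two members of `A`. Its alternate vertices
      -- form `B`; giving them a second colour makes the other three slack.
      A B F : List (Fin n)
      A = u ∷ y ∷ z ∷ []
      B = p ∷ w₃ ∷ w₄ ∷ []
      F = A ++ B

      κ : Fin n → Colour
      κ w = if does (w ∈?ᵛ A) then c else d

      κ-A : ∀ {w} → w ∈ A → κ w ≡ c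
      κ-A {w} = proj₁ (if-dec (w ∈?ᵛ A))

      κ-∉A : ∀ {w} → w ∉ A → κ w ≡ d
      κ-∉A {w} = proj₂ (if-dec (w ∈?ᵛ A))

      κ-d : ∀ {w} → w ≢ u → w ≢ y → w ≢ z → κ w ≡ d
      κ-d p q r = κ-∉A λ where
        (here e) → p e
        (there (here e)) → q e
        (there (there (here e))) → r e

      independent-three : ∀ {a b c} → a ≁ b → a ≁ c → b ≁ c →
        ∀ {f g} → f ∈ a ∷ b ∷ c ∷ [] → g ∈ a ∷ b ∷ c ∷ [] → f ≁ g
      independent-three ab ac bc (here refl) (here refl) e = ~⇒≢ e refl
      independent-three ab ac bc (here refl) (there (here refl)) = ab
      independent-three ab ac bc (here refl) (there (there (here refl))) = ac
      independent-three ab ac bc (there (here refl)) (here refl) = ab ∘ ~-sym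
      independent-three ab ac bc (there (here refl)) (there (here refl)) e = ~⇒≢ e refl
      independent-three ab ac bc (there (here refl)) (there (there (here refl))) = bc
      independent-three ab ac bc (there (there (here refl))) (here refl) = ac ∘ ~-sym
      independent-three ab ac bc (there (there (here refl))) (there (here refl)) = bc ∘ ~-sym
      independent-three ab ac bc (there (there (here refl))) (there (there (here refl))) e = ~⇒≢ e refl

      A-independent : ∀ {f g} → f ∈ A → g ∈ A → f ≁ g
      A-independent = independent-three (tf (N3.ax V) v~y) (tf (N3.ax V) v~z) (tf v~y v~z)

      B-independent : ∀ {f g} → f ∈ B → g ∈ B → f ≁ g
      B-independent = independent-three
        (λ e → N3.y≢z U (qf (≢-sym w₃≢u) u~p e u~r r~w₃))
        (λ e → N3.y≢z U (qf (≢-sym w₄≢u) u~p e u~r r~w₄)) (tf r~w₃ r~w₄)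

      in-B : ∀ {f} → f ∈ F → f ∉ A → f ∈ B
      in-B f∈ f∉ with ∈-++⁻ A f∈
      ... | inj₁ f∈A = contradiction f∈A f∉
      ... | inj₂ f∈B = f∈B

      κ-proper : ∀ {f g} → f ∈ F → g ∈ F → f ~ g → κ f ≢ κ g
      κ-proper {f} {g} f∈ g∈ a e = case (f ∈?ᵛ A) ,′ (g ∈?ᵛ A) of λ where
        (yes fA , yes gA) → A-independent fA gA a
        (yes fA , no g∉) → c≢d (trans (≡-sym (κ-A fA)) (trans e (κ-∉A g∉)))
        (no f∉ , yes gA) → c≢d (trans (≡-sym (κ-A gA)) (trans (≡-sym e) (κ-∉A f∉)))
        (no f∉ , no g∉) → B-independent (in-B f∈ f∉) (in-B g∈ g∉) a

      κ∈ : ∀ {f} → f ∈ F → κ f ∈ L f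
      κ∈ {f} _ = case f ∈?ᵛ A of λ where
        (yes fA) → subst (_∈ L f) (≡-sym (κ-A fA)) (same c∈)
        (no f∉) → subst (_∈ L f) (≡-sym (κ-∉A f∉)) (same d∈)

      module Pin = Pinned G L unique bounded F κ κ-proper κ∈

      p∈ : p ∈ F
      p∈ = ∈-++⁺ʳ A (here refl)
      w₃∈ : w₃ ∈ F
      w₃∈ = ∈-++⁺ʳ A (there (here refl))
      w₄∈ : w₄ ∈ F
      w₄∈ = ∈-++⁺ʳ A (there (there (here refl)))
      κp : κ p ≡ d
      κp = κ-d p≢u p≢y p≢z
      κw₃ : κ w₃ ≡ d
      κw₃ = κ-d w₃≢u (≢-sym y≢w₃) (≢-sym z≢w₃)
      κw₄ : κ w₄ ≡ d
      κw₄ = κ-d w₄≢u (≢-sym y≢w₄) (≢-sym z≢w₄)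

      slack-vertex : ∀ {x} → x ∈ v ∷ r ∷ w₁ ∷ w₂ ∷ [] → Pin.PinSlack x
      slack-vertex (here refl) = inj₂ (u , y , here refl , there (here refl) , ≢-sym y≢u , N3.ax V , v~y ,
        trans (κ-A (here refl)) (≡-sym (κ-A (there (here refl)))))
      slack-vertex (there (here refl)) =
        inj₂ (w₃ , w₄ , w₃∈ , w₄∈ , N3.y≢z R , r~w₃ , r~w₄ , trans κw₃ (≡-sym κw₄))
      slack-vertex (there (there (here refl))) =
        inj₂ (p , w₄ , p∈ , w₄∈ , p≢w₄ , ~-sym p~w₁ , w₁~w₄ , trans κp (≡-sym κw₄))
      slack-vertex (there (there (there (here refl)))) =
        inj₂ (p , w₃ , p∈ , w₃∈ , p≢w₃ , ~-sym p~w₂ , w₂~w₃ , trans κp (≡-sym κw₃))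

      -- The ten named vertices; being closed under adjacency, they are the whole graph.
      N : Fin n → Set
      N x = x ∈ (v ∷ r ∷ w₁ ∷ w₂ ∷ []) ++ F

      three : ∀ {x a b c} → N3 G x a b c → N a → N b → N c → ∀ {w} → x ~ w → N w
      three X a∈ b∈ c∈ e with N3.all X e
      ... | inj₁ refl = a∈
      ... | inj₂ (inj₁ refl) = b∈
      ... | inj₂ (inj₂ refl) = c∈

      N-v : N v
      N-v = here refl
      N-r : N r
      N-r = there (here refl)
      N-w₁ : N w₁
      N-w₁ = there (there (here refl))
      N-w₂ : N w₂
      N-w₂ = there (there (there (here refl)))
      N-F : ∀ {x} → x ∈ F → N x
      N-F = ∈-++⁺ʳ (v ∷ r ∷ w₁ ∷ w₂ ∷ [])
      N-u : N u
      N-u = N-F (here refl)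
      N-y : N y
      N-y = N-F (there (here refl))
      N-z : N z
      N-z = N-F (there (there (here refl)))

      closed : ∀ {x w} → N x → x ~ w → N w
      closed (here refl) = three V N-u N-y N-z
      closed (there (here refl)) = three R N-u (N-F w₃∈) (N-F w₄∈)
      closed (there (there (here refl))) = three
        (nbhd-with₃ (~-sym p~w₁) (~-sym z~w₁) w₁~w₄ p≢z p≢w₄ z≢w₄) (N-F p∈) N-z (N-F w₄∈)
      closed (there (there (there (here refl)))) = three
        (nbhd-with₃ (~-sym p~w₂) (~-sym y~w₂) w₂~w₃ p≢y p≢w₃ y≢w₃) (N-F p∈) N-y (N-F w₃∈)
      closed (there (there (there (there (here refl))))) = three U N-v (N-F p∈) N-r
      closed (there (there (there (there (there (here refl)))))) = three
        (nbhd-with₃ (~-sym v~y) y~w₂ y~w₄ v≢w₂ v≢w₄ w₂≢w₄) N-v N-w₂ (N-F w₄∈)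
      closed (there (there (there (there (there (there (here refl))))))) = three
        (nbhd-with₃ (~-sym v~z) z~w₁ z~w₃ v≢w₁ v≢w₃ w₁≢w₃) N-v N-w₁ (N-F w₃∈)
      closed (there (there (there (there (there (there (there (here refl)))))))) = three P N-u N-w₁ N-w₂
      closed (there (there (there (there (there (there (there (there (here refl))))))))) = three
        (nbhd-with₃ (~-sym r~w₃) (~-sym z~w₃) (~-sym w₂~w₃) r≢z r≢w₂ z≢w₂) N-r N-z N-w₂
      closed (there (there (there (there (there (there (there (there (there (here refl)))))))))) = three
        (nbhd-with₃ (~-sym r~w₄) (~-sym y~w₄) (~-sym w₁~w₄) r≢y r≢w₁ y≢w₁) N-r N-y N-w₁

      slack : ∀ {w} → w ∉ F → ∃ λ t → Pin.PinSlack t × Reach G (_∉ F) w t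
      slack {w} w∉ with ∈-++⁻ (v ∷ r ∷ w₁ ∷ w₂ ∷ [])
                          (reach-closed {Q = N} (λ x∈ e _ → closed x∈ e) N-v (connected v w))
      ... | inj₁ w∈ = w , slack-vertex w∈ , here w∉
      ... | inj₂ w∈ = contradiction w∈ w∉

      petersen-mono : Mono u y z
      petersen-mono with Pin.pinned-exists slack
      ... | χ , cχ , e = χ , cχ ,
        trans (trans (e (here refl)) (κ-A (here refl)))
          (≡-sym (trans (e (there (here refl))) (κ-A (there (here refl))))) ,
        trans (trans (e (here refl)) (κ-A (here refl)))
          (≡-sym (trans (e (there (there (here refl)))) (κ-A (there (there (here refl))))))

    two-colours : ∀ v → ∃ λ c → ∃ λ d → c ∈ L v × d ∈ L v × c ≢ d
    two-colours v with L v | assign v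
    ... | c ∷ d ∷ _ | ((c≢d ∷ _) ∷ _) , _ = c , d , here refl , there (here refl) , c≢d

    dense : ∀ {u v p r y z w₁ w₂ w₃ w₄} → Spider u v p r y z w₁ w₂ w₃ w₄ →
      y ~ w₂ → y ~ w₄ → z ~ w₁ → z ~ w₃ → Joined u y u z
    dense {u} {w₁ = w₁} {w₂} {w₃} {w₄} S y~w₂ y~w₄ z~w₁ z~w₃ with adj? G w₁ w₄ | adj? G w₂ w₃
    ... | no w₁≁w₄ | _ = dense-link S y~w₂ y~w₄ z~w₁ z~w₃ w₁≁w₄
    ... | _ | no w₂≁w₃ = dense-link (swap-pr S) y~w₄ y~w₂ z~w₃ z~w₁ (w₂≁w₃ ∘ ~-sym)
    ... | yes w₁~w₄ | yes w₂~w₃ with two-colours u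
    ...   | c , d , c∈ , d∈ , c≢d = mono-joined
              (outer-good (N3.ax V) v~y y≢u) (outer-good (N3.ax V) v~z z≢u)
              (Petersen.petersen-mono S y~w₂ y~w₄ z~w₁ z~w₃ w₁~w₄ w₂~w₃ c∈ d∈ c≢d)
      where open Leaves S

    -- If all four stations are blocked, each is adjacent to `y` or `z`. Neither can have both of
    -- `w₁`, `w₂` or both of `w₃`, `w₄` without closing a four-cycle, so up to relabelling the
    -- pattern is that of `dense`.
    spider-joined : ∀ {u v p r y z w₁ w₂ w₃ w₄} → Spider u v p r y z w₁ w₂ w₃ w₄ → Joined u y u z
    spider-joined {u} {v} {p} {r} {y} {z} {w₁} {w₂} {w₃} {w₄} S
      with w₁-blocked S | w₁-blocked (swap-w₁w₂ S) | w₁-blocked (swap-pr S) | w₁-blocked (swap-w₁w₂ (swap-pr S))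
    ... | inj₁ J | _ | _ | _ = J
    ... | _ | inj₁ J | _ | _ = J
    ... | _ | _ | inj₁ J | _ = J
    ... | _ | _ | _ | inj₁ J = J
    ... | inj₂ b₁ | inj₂ b₂ | inj₂ b₃ | inj₂ b₄ = by-cases b₁ b₂ b₃ b₄
      where
      open Leaves S
      not-both-p : ∀ {x} → p ≢ x → x ~ w₁ → x ~ w₂ → ⊥
      not-both-p p≢x a b = N3.y≢z P (qf p≢x p~w₁ (~-sym a) p~w₂ (~-sym b))
      not-both-r : ∀ {x} → r ≢ x → x ~ w₃ → x ~ w₄ → ⊥
      not-both-r r≢x a b = N3.y≢z R (qf r≢x r~w₃ (~-sym a) r~w₄ (~-sym b))
      by-cases : y ~ w₁ ⊎ z ~ w₁ → y ~ w₂ ⊎ z ~ w₂ → y ~ w₃ ⊎ z ~ w₃ → y ~ w₄ ⊎ z ~ w₄ → Joined u y u z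
      by-cases (inj₁ a) (inj₁ b) _ _ = ⊥-elim (not-both-p p≢y a b)
      by-cases (inj₂ a) (inj₂ b) _ _ = ⊥-elim (not-both-p p≢z a b)
      by-cases _ _ (inj₁ a) (inj₁ b) = ⊥-elim (not-both-r r≢y a b)
      by-cases _ _ (inj₂ a) (inj₂ b) = ⊥-elim (not-both-r r≢z a b)
      by-cases (inj₂ a) (inj₁ b) (inj₂ c) (inj₁ d) = dense S b d a c
      by-cases (inj₂ a) (inj₁ b) (inj₁ c) (inj₂ d) = dense (swap-w₃w₄ S) b c a d
      by-cases (inj₁ a) (inj₂ b) (inj₂ c) (inj₁ d) = dense (swap-w₁w₂ S) a d b c
      by-cases (inj₁ a) (inj₂ b) (inj₁ c) (inj₂ d) = dense (swap-w₁w₂ (swap-w₃w₄ S)) a c b d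

    edge-joined : ∀ {u v y z} → N3 G v u y z → Joined u y u z
    edge-joined V with nbhd-with₁ (~-sym (N3.ax V))
    ... | p , r , U with nbhd-with₁ (~-sym (N3.ay U)) | nbhd-with₁ (~-sym (N3.az U))
    ...   | _ , _ , P | _ , _ , R = spider-joined (record { U = U ; V = V ; P = P ; R = R })

    girth5 : Fin n → AllEquivalent
    girth5 v with nbhd v
    ... | x , y , z , V = claw V (good x≢y (tf ax ay) ax ay) (joined-sym (edge-joined V))
        (λ cφ cψ e e′ → joined-sym (edge-joined (N3-swap₁₂ V)) cφ cψ e (≡-sym e′))
      where open N3 V

-- Combining the cases

module _ {n : ℕ} (G : Graph n) (L : ListAssignment n)
  (reg : Regular G 3) (conn : KConnected G 3) (assign : IsKAssignment 3 L) where

  open Cubic G L reg conn assign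

  equal-swappable : (∀ {v w c} → c ∈ L v → c ∈ L w) →
    ¬ IsoTo G (Fin 4) K4Adj → ¬ IsoTo G (Fin 2 × Fin 3) PrismAdj →
    Fin n → ∀ {φ ψ} → Col φ → Col ψ → φ ≋ ψ
  equal-swappable same not-K4 not-prism v₀
    with any? (λ a → any? λ b → any? λ c → adj? G a b ×-dec (adj? G a c ×-dec adj? G b c))
  ... | yes (a , b , c , ab , ac , bc) = triangle not-K4 not-prism ab ac bc
    where open Equal G L reg conn assign same
  ... | no no-triangle
    with any? (λ a → any? λ b → any? λ c → any? λ d → ¬? (a ≟ c) ×-dec (¬? (b ≟ d) ×-dec
           ((adj? G a b ×-dec adj? G b c) ×-dec (adj? G a d ×-dec adj? G d c))))
  ... | yes (a , b , c , d , a≢c , b≢d , (ab , bc) , (ad , dc)) = four-cycle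
          (proj₂ (nbhd-with₂ ab ad b≢d)) a≢c (~-sym bc) (~-sym dc)
    where open TriangleFree G L reg conn assign same (λ p q r → no-triangle (_ , _ , _ , p , q , r))
  ... | no no-four-cycle = girth5 v₀
    where
    open TriangleFree G L reg conn assign same (λ p q r → no-triangle (_ , _ , _ , p , q , r))
    qf : ∀ {a b c d} → a ≢ c → a ~ b → b ~ c → a ~ d → d ~ c → b ≡ d
    qf {a} {b} {c} {d} a≢c ab bc ad dc with b ≟ d
    ... | yes b≡d = b≡d
    ... | no b≢d = contradiction (a , b , c , d , a≢c , b≢d , (ab , bc) , (ad , dc)) no-four-cycle
    open Girth5 qf

  good-pair : ¬ IsoTo G (Fin 4) K4Adj → Fin n →
    ∃ λ v → ∃ λ x → ∃ λ y → x ≢ y × x ≁ y × v ~ x × v ~ y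
  good-pair not-K4 v with nbhd v
  ... | x , y , z , V with adj? G x y | adj? G x z | adj? G y z
  ... | no xy | _ | _ = v , x , y , N3.x≢y V , xy , N3.ax V , N3.ay V
  ... | _ | no xz | _ = v , x , z , N3.x≢z V , xz , N3.ax V , N3.az V
  ... | _ | _ | no yz = v , y , z , N3.y≢z V , yz , N3.ay V , N3.az V
  ... | yes xy | yes xz | yes yz = contradiction (iso-K4 connected V
          (nbhd-with₃ (~-sym ax) xy xz (~⇒≢ ay) (~⇒≢ az) y≢z)
          (nbhd-with₃ (~-sym ay) (~-sym xy) yz (~⇒≢ ax) (~⇒≢ az) x≢z)
          (nbhd-with₃ (~-sym az) (~-sym xz) (~-sym yz) (~⇒≢ ax) (~⇒≢ ay) x≢y)) not-K4
    where open N3 V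

theorem3 : ∀ (n : ℕ) (G : Graph n) (L : ListAssignment n) →
    Regular G 3 → Connectivity≡ G 3 → IsKAssignment 3 L →
    ¬ IsoTo G (Fin 4) K4Adj →
    ¬ (IsoTo G (Fin 2 × Fin 3) PrismAdj × AllListsEqual L) →
    LSwappable G L
theorem3 n G L reg (conn , _) assign not-K4 not-prism
  -- Comparing lists along edges is enough: if no edge shows a difference, connectedness makes all
  -- lists agree.
  with any? (λ u → any? λ v → adj? G u v ×-dec Any.any? (λ α → ¬? (α ∈?ᶜ L v)) (L u))
... | yes (u , v , a , found) = let α , α∈ , α∉ = find found in unequal-swappable (a , α∈ , α∉)
  where open Cubic.Unequal G L reg conn assign
... | no none = (let φ , cφ , _ = good-exists gd in φ , cφ) , λ φ ψ →
    equal-swappable G L reg conn assign same not-K4 (λ iso → not-prism (iso , λ v w c → mk⇔ same same)) v₀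
  where
  open Cubic G L reg conn assign
  edge : ∀ {u v} → u ~ v → ∀ {c} → c ∈ L u → c ∈ L v
  edge {u} {v} a {c} c∈ with c ∈?ᶜ L v
  ... | yes c∈v = c∈v
  ... | no c∉v = contradiction (u , v , a , lose c∈ c∉v) none
  same : ∀ {v w c} → c ∈ L v → c ∈ L w
  same {v} {w} {c} c∈ = reach-closed {Q = λ x → c ∈ L x} (λ c∈x a _ → edge a c∈x) c∈ (connected v w)
  open Equal G L reg conn assign same
  v₀ : Fin n
  -- Deleting the empty set leaves two distinct vertices, so there is at least one.
  v₀ = proj₁ (proj₁ (conn Sub.⊥ (subst (_< 3) (≡-sym (∣⊥∣≡0 n)) (s≤s z≤n))))
  gd : Good _ _
  gd = let _ , _ , _ , x≢y , x≁y , a , b = good-pair G L reg conn assign not-K4 v₀ in good x≢y x≁y a b
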